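{- Let $G$ be a finite simple graph, $\theta$ a real number, and $u,v$ distinct vertices in $P_\theta(G)\cup N_\theta(G)$. Then $A_\theta(G)$ is a $\theta$-extreme set in $G\setminus uv$, i.e. $\textnormal{mult}(\theta,G\setminus(A_\theta(G)\cup\{u,v\}))=\textnormal{mult}(\theta,G\setminus uv)+|A_\theta(G)|$.
   Context: $\mu(G,x)=\sum_{r\ge 0}(-1)^r p(G,r)x^{|V(G)|-2r}$ is the matching polynomial ($p(G,r)$ = number of $r$-matchings, $p(G,0)=1$, empty graph has $\mu=1$); $\textnormal{mult}(\theta,G)$ is the multiplicity of $\theta$ as a root of $\mu(G,x)$ ($0$ if not a root). $G\setminus X$, $G\setminus uv$ denote vertex deletion. A vertex $u$ is $\theta$-essential if $\textnormal{mult}(\theta,G\setminus u)=\textnormal{mult}(\theta,G)-1$, $\theta$-neutral if $\textnormal{mult}(\theta,G\setminus u)=\textnormal{mult}(\theta,G)$, $\theta$-positive if $\textnormal{mult}(\theta,G\setminus u)=\textnormal{mult}(\theta,G)+1$, and $\theta$-special if it is not $\theta$-essential but adjacent to a $\theta$-essential vertex. $A_\theta(G)$ and $N_\theta(G)$ are the sets of $\theta$-special and $\theta$-neutral vertices, and $P_\theta(G)$ is the set of $\theta$-positive vertices that are not $\theta$-special. A set $X$ is $\theta$-extreme in a graph $F$ if $\textnormal{mult}(\theta,F\setminus X)=\textnormal{mult}(\theta,F)+|X|$. -}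

module Defs where

open import Level using (0ℓ)
open import Data.Nat as ℕ using (ℕ; zero; suc; _∸_; _<ᵇ_; _≤ᵇ_; _≡ᵇ_)
open import Data.Integer as ℤ using (ℤ; +_; -[1+_])
open import Data.Bool using (Bool; true; false; _∧_; _∨_; if_then_else_)
open import Data.Fin using (Fin; toℕ)
open import Data.Fin.Subset using (Subset; _∈_; ⊤; _─_; _-_; ∣_∣; ⁅_⁆; _∪_)
open import Data.Vec as Vec using (Vec; []; _∷_; lookup)
open import Data.List as List using (List; []; _∷_; allFin; upTo; filter; length; concatMap)
open import Data.Product using (Σ; ∃; _×_; _,_)
open import Data.Sum using (_⊎_)
open import Relation.Nullary using (¬_)
open import Relation.Binary.PropositionalEquality using (_≡_)
open import Relation.Binary using (Rel; IsTotalOrder)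
open import Algebra.Structures using (IsCommutativeRing)
open import Function using (_∘_)
import Data.Nat.ListAction as LA
import Data.Bool.ListAction as BA

-- Real numbers: agda-stdlib has no ℝ, so we abstract over an arbitrary
-- model of the axioms of the reals (a complete ordered field).

record RealField : Set₁ where
  infix  4 _≈_ _≤_
  infixl 6 _+_
  infixl 7 _*_
  field
    Carrier : Set
    _≈_     : Rel Carrier 0ℓ
    _≤_     : Rel Carrier 0ℓ
    _+_     : Carrier → Carrier → Carrier
    _*_     : Carrier → Carrier → Carrier
    -_      : Carrier → Carrier
    0#      : Carrier
    1#      : Carrier
    isCommutativeRing : IsCommutativeRing _≈_ _+_ _*_ -_ 0# 1#
    0≉1     : ¬ (0# ≈ 1#)
    inverse : ∀ x → ¬ (x ≈ 0#) → ∃ λ y → x * y ≈ 1#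
    isTotalOrder : IsTotalOrder _≈_ _≤_
    +-mono-≤ : ∀ {x y} z → x ≤ y → x + z ≤ y + z
    *-nonneg : ∀ {x y} → 0# ≤ x → 0# ≤ y → 0# ≤ x * y
    complete : (P : Carrier → Set) → (∃ P) → (∃ λ b → ∀ x → P x → x ≤ b) →
               ∃ λ s → (∀ x → P x → x ≤ s) × (∀ b → (∀ x → P x → x ≤ b) → s ≤ b)

record Graph (n : ℕ) : Set where
  field
    adj     : Fin n → Fin n → Bool
    adj-sym : ∀ i j → adj i j ≡ adj j i
    adj-irr : ∀ i → adj i i ≡ false

open Graph public

-- Matchings of the induced subgraph G[S] (S = set of remaining vertices,
-- so G \ X is G[⊤ ─ X]).
-- An edge set is M : Vec (Subset n) n; the pair (i , j) is chosen iff
-- j ∈ lookup M i; chosen pairs must satisfy i < j (each edge once).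

allVecs : {A : Set} → List A → (k : ℕ) → List (Vec A k)
allVecs xs zero    = [] ∷ []
allVecs xs (suc k) = concatMap (λ x → List.map (x ∷_) (allVecs xs k)) xs

EdgeSet : ℕ → Set
EdgeSet n = Vec (Subset n) n

allEdgeSets : (n : ℕ) → List (EdgeSet n)
allEdgeSets n = allVecs (allVecs (true ∷ false ∷ []) n) n

chosen : ∀ {n} → EdgeSet n → Fin n → Fin n → Bool
chosen M i j = lookup (lookup M i) j

allᶠ : ∀ {n} → (Fin n → Bool) → Bool
allᶠ {n} f = BA.all f (allFin n)

countᶠ : ∀ {n} → (Fin n → Bool) → ℕ
countᶠ {n} f = length (filter (λ i → Data.Bool._≟_ (f i) true) (allFin n))
  where import Data.Bool

imp : Bool → Bool → Bool
imp a b = if a then b else true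

isMatching : ∀ {n} → Graph n → Subset n → EdgeSet n → Bool
isMatching G S M =
  allᶠ (λ i → allᶠ (λ j → imp (chosen M i j)
        ((toℕ i <ᵇ toℕ j) ∧ adj G i j ∧ Vec.lookup S i ∧ Vec.lookup S j)))
  ∧ allᶠ (λ v → countᶠ (λ w → chosen M v w ∨ chosen M w v) ≤ᵇ 1)

size : ∀ {n} → EdgeSet n → ℕ
size M = LA.sum (List.map (λ i → ∣ lookup M i ∣) (allFin _))

numMatchings : ∀ {n} → Graph n → Subset n → ℕ → ℕ
numMatchings {n} G S r =
  length (filter (λ M → Data.Bool._≟_ (isMatching G S M ∧ (size M ≡ᵇ r)) true)
                 (allEdgeSets n))
  where import Data.Bool

module Poly (R : RealField) where
  open RealField R

  Pol : Set
  Pol = List Carrier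

  coeff : Pol → ℕ → Carrier
  coeff []       _       = 0#
  coeff (a ∷ p)  zero    = a
  coeff (a ∷ p)  (suc i) = coeff p i

  _≈P_ : Pol → Pol → Set
  p ≈P q = ∀ i → coeff p i ≈ coeff q i

  _+P_ : Pol → Pol → Pol
  []      +P q       = q
  p       +P []      = p
  (a ∷ p) +P (b ∷ q) = (a + b) ∷ (p +P q)

  scale : Carrier → Pol → Pol
  scale c = List.map (c *_)

  _*P_ : Pol → Pol → Pol
  []      *P q = []
  (a ∷ p) *P q = scale a q +P (0# ∷ (p *P q))

  _^P_ : Pol → ℕ → Pol
  p ^P zero  = 1# ∷ []
  p ^P suc k = p *P (p ^P k)

  monomial : Carrier → ℕ → Pol
  monomial c zero    = c ∷ []
  monomial c (suc k) = 0# ∷ monomial c k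

  fromℕ : ℕ → Carrier
  fromℕ zero    = 0#
  fromℕ (suc k) = 1# + fromℕ k

  fromℤ : ℤ → Carrier
  fromℤ (+ k)      = fromℕ k
  fromℤ -[1+ k ]   = - fromℕ (suc k)

  _∣[x-_]^_ : Pol → Carrier → ℕ → Set
  _∣[x-_]^_ p θ k = ∃ λ q → p ≈P (((- θ ∷ 1# ∷ []) ^P k) *P q)

  IsMult : Carrier → Pol → ℕ → Set
  IsMult θ p k = (p ∣[x- θ ]^ k) × ¬ (p ∣[x- θ ]^ suc k)

-- matching polynomial μ(G[S], x) = Σ_r (-1)^r p(G[S],r) x^{|S|-2r}
-- (terms with 2r > |S| vanish since then p(G[S],r) = 0)
matchingPoly : (R : RealField) → ∀ {n} → Graph n → Subset n → Poly.Pol R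
matchingPoly R G S =
  List.foldr _+P_ [] (List.map term (upTo (suc ∣ S ∣)))
  where
  open Poly R
  sign : ℕ → ℤ
  sign r = if ℕ._%_ r 2 ≡ᵇ 0 then + 1 else -[1+ 0 ]
  term : ℕ → Pol
  term r = monomial (fromℤ (sign r ℤ.* (+ numMatchings G S r))) (∣ S ∣ ∸ 2 ℕ.* r)

Mult : (R : RealField) → RealField.Carrier R → ∀ {n} → Graph n → Subset n → ℕ → Set
Mult R θ G S k = Poly.IsMult R θ (matchingPoly R G S) k

module _ (R : RealField) (θ : RealField.Carrier R) {n : ℕ} (G : Graph n) where

  Essential : Fin n → Set
  Essential u = ∃ λ m → Mult R θ G ⊤ (suc m) × Mult R θ G (⊤ - u) m

  Neutral : Fin n → Set
  Neutral u = ∃ λ m → Mult R θ G ⊤ m × Mult R θ G (⊤ - u) m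

  Positive : Fin n → Set
  Positive u = ∃ λ m → Mult R θ G ⊤ m × Mult R θ G (⊤ - u) (suc m)

  Special : Fin n → Set
  Special u = ¬ Essential u × ∃ λ w → adj G u w ≡ true × Essential w

  InPN : Fin n → Set
  InPN u = (Positive u × ¬ Special u) ⊎ Neutral u

{-# OPTIONS --safe #-}
module Submission where

-- Expand μ(G[S]) at θ as a power series f S in t = x - θ, so that multiplicities
-- become orders of vanishing. The vertex recurrence for matchings gives, for u ≠ v,
-- f(S-u) f(S-v) - f(S) f(S-u-v) = Σ_P f(S-P)² over the paths P from u to v in G[S];
-- hence this difference has even order, and its order bounds that of every summand.
-- Together with f' = Σ_v f(S-v), it yields interlacing: deleting a vertex changes
-- the multiplicity by at most one.
--
-- The key step is the stability lemma: if a is special in S and b ≠ a is another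
-- vertex, then deleting a raises the multiplicity of S - b by one. Its only hard
-- case (b positive, a essential in S - b) is excluded by giving an essential
-- neighbour w of a a loop, i.e. replacing f(S) by f(S) + f(S-w): this keeps the
-- recurrence, but the difference above for a, b would acquire odd order.
--
-- For u inessential, special vertices of G stay special in G \ u, so deleting
-- them one by one from (G \ u) \ v raises the multiplicity by one each time.

open import Level using (0ℓ)
open import Defs
open import Data.Nat as ℕ using (ℕ; zero; suc; _<_; s≤s; z≤n; _≡ᵇ_; _≤ᵇ_; _<ᵇ_)
import Data.Nat.Properties as ℕₚ
import Data.Nat.DivMod as DivMod
import Data.Nat.ListAction as ListActionℕ
open import Data.Integer as ℤ using (+_; -[1+_])
import Data.Integer.Properties as ℤₚ
open import Data.Bool as Bool using (Bool; true; false; _∧_; _∨_; not; T; if_then_else_)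
import Data.Bool.Properties as Boolₚ
import Data.Bool.ListAction as ListActionBool
open import Data.Fin using (Fin; zero; suc; toℕ)
import Data.Fin.Properties as Finₚ
open import Data.Fin.Properties using (_≟_)
open import Data.Fin.Subset using (Subset; _∈_; _∉_; _⊆_; ⊤; _─_; _-_; ∣_∣; ⁅_⁆; _∪_; Empty)
import Data.Fin.Subset.Properties as Subₚ
open import Data.List as List using (List; []; _∷_; _++_; allFin; tabulate; filter; length; concatMap; applyUpTo)
open import Data.Vec using (lookup; _∷_; []; here; there; updateAt)
import Data.Vec.Properties as Vecₚ
open import Data.Product using (∃; _×_; _,_; proj₁; proj₂)
open import Data.Sum using (_⊎_; inj₁; inj₂; [_,_])
open import Data.Empty using (⊥-elim)
open import Function using (_∘_; id)
open import Function.Bundles using (_⇔_; Equivalence)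
open import Relation.Nullary using (¬_; Dec; yes; no; does)
open import Relation.Binary using (IsTotalOrder; tri<; tri≈; tri>)
open import Relation.Binary.PropositionalEquality as ≡ using (_≡_; _≢_)
open import Algebra.Bundles using (CommutativeRing)
import Algebra.Construct.Pointwise
import Algebra.Properties.CommutativeMonoid.Mult
import Algebra.Properties.CommutativeMonoid.Sum
import Algebra.Properties.CommutativeSemigroup
import Algebra.Properties.Group
import Algebra.Properties.Ring
import Algebra.Properties.Semiring.Mult
import Algebra.Properties.Semiring.Sum
import Relation.Binary.Reasoning.Setoid

-- The path identity is never written as a sum over paths. Unfolding the recurrence at `u` expresses
-- the difference through the same difference on smaller sets, and all that is kept of the squares
-- is the pair of properties in `NonNegGerm`, which sums preserve. Interlacing uses the same
-- mechanism: the Wronskian of f(S-u) and f(S) is a sum of such differences and of f(S-u)².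
--
-- The loop is there because parity alone does not settle the hard case. Write k for the
-- multiplicity of S. Then S - a and S - b have multiplicity k + 1 and S - a - b has k, so the
-- difference for a, b has order 2k, which is allowed. The loop at w lowers the order at S to k - 1,
-- leaves it at k for S - a - b and keeps it at least k for S - a and S - b. Now the difference has
-- order 2k - 1.
--
-- Orders make sense only if the vanishing of a coefficient can be decided. Excluded middle is not
-- assumed; the decision is extracted from the least upper bound axiom, and interlacing bounds the
-- search for the first nonzero coefficient.

-- Ordered fields: deciding equality with zero

module OrderedField (R : RealField) where
  open RealField R using (inverse; 0≉1; isTotalOrder; +-mono-≤; *-nonneg; complete; _≤_)

  commutativeRing : CommutativeRing 0ℓ 0ℓ
  commutativeRing = record { isCommutativeRing = RealField.isCommutativeRing R }

  open CommutativeRing commutativeRing public hiding (_-_; zero)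
  open Algebra.Properties.Ring ring using (-‿distribˡ-*; -‿distribʳ-*; -‿involutive; -0#≈0#)
  open Relation.Binary.Reasoning.Setoid setoid
  private module O = IsTotalOrder isTotalOrder

  ≤-resp : ∀ {x x′ y y′} → x ≈ x′ → y ≈ y′ → x ≤ y → x′ ≤ y′
  ≤-resp e f p = O.trans (O.reflexive (sym e)) (O.trans p (O.reflexive f))

  neg-nonneg : ∀ {x} → x ≤ 0# → 0# ≤ - x
  neg-nonneg {x} p = ≤-resp (-‿inverseʳ x) (+-identityˡ (- x)) (+-mono-≤ (- x) p)

  square-nonneg : ∀ x → 0# ≤ x * x
  square-nonneg x with O.total 0# x
  ... | inj₁ p = *-nonneg p p
  ... | inj₂ p = ≤-resp refl neg-square (*-nonneg (neg-nonneg p) (neg-nonneg p))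
    where
    neg-square : - x * - x ≈ x * x
    neg-square = begin
      - x * - x     ≈⟨ -‿distribˡ-* x (- x) ⟨
      - (x * - x)   ≈⟨ -‿cong (-‿distribʳ-* x x) ⟨
      - - (x * x)   ≈⟨ -‿involutive (x * x) ⟩
      x * x         ∎

  0≤1 : 0# ≤ 1#
  0≤1 = ≤-resp refl (*-identityˡ 1#) (square-nonneg 1#)

  1≰0 : ¬ (1# ≤ 0#)
  1≰0 p = 0≉1 (O.antisym 0≤1 p)

  +-nonneg : ∀ {x y} → 0# ≤ x → 0# ≤ y → 0# ≤ x + y
  +-nonneg {x} {y} p q = O.trans q (≤-resp (+-identityˡ y) refl (+-mono-≤ y p))

  sum-zeroˡ : ∀ {x y} → 0# ≤ x → 0# ≤ y → x + y ≈ 0# → x ≈ 0#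
  sum-zeroˡ {x} {y} p q e = O.antisym x≤0 p
    where
    x≤0 : x ≤ 0#
    x≤0 = ≤-resp (+-identityˡ x) (trans (+-comm y x) e) (+-mono-≤ x q)

  -- Completeness decides every negated proposition: compare with 1 the
  -- supremum of {0} ∪ {2 | Q}.
  weak-excluded-middle : (Q : Set) → ¬ Q ⊎ ¬ ¬ Q
  weak-excluded-middle Q = decide (O.total s 1#)
    where
    2# : Carrier
    2# = 1# + 1#
    P : Carrier → Set
    P z = z ≈ 0# ⊎ (z ≈ 2# × Q)
    bound : ∀ z → P z → z ≤ 2#
    bound z (inj₁ e)       = ≤-resp (sym e) refl (+-nonneg 0≤1 0≤1)
    bound z (inj₂ (e , _)) = O.reflexive e
    sup : ∃ λ s → (∀ z → P z → z ≤ s) × (∀ b → (∀ z → P z → z ≤ b) → s ≤ b)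
    sup = complete P (0# , inj₁ refl) (2# , bound)
    s : Carrier
    s = proj₁ sup
    drop-1 : 2# ≤ 1# → 1# ≤ 0#
    drop-1 p = ≤-resp (begin
        2# + - 1#         ≈⟨ +-assoc 1# 1# (- 1#) ⟩
        1# + (1# + - 1#)  ≈⟨ +-congˡ (-‿inverseʳ 1#) ⟩
        1# + 0#           ≈⟨ +-identityʳ 1# ⟩
        1#                ∎) (-‿inverseʳ 1#) (+-mono-≤ (- 1#) p)
    decide : s ≤ 1# ⊎ 1# ≤ s → ¬ Q ⊎ ¬ ¬ Q
    decide (inj₁ s≤1) = inj₁ λ q → 1≰0 (drop-1 (O.trans (proj₁ (proj₂ sup) 2# (inj₂ (refl , q))) s≤1))
    decide (inj₂ 1≤s) = inj₂ λ ¬q → 1≰0 (O.trans 1≤s (proj₂ (proj₂ sup) 0# λ where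
      z (inj₁ e)       → O.reflexive e
      z (inj₂ (_ , q)) → ⊥-elim (¬q q)))

  open Algebra.Properties.CommutativeMonoid.Mult +-commutativeMonoid public
    using () renaming (_×_ to _·_; ×-congʳ to ·-congʳ; ×-distrib-+ to ·-distrib-+)

  ·-zero : ∀ k {x} → x ≈ 0# → k · x ≈ 0#
  ·-zero zero    e = refl
  ·-zero (suc k) e = trans (+-cong e (·-zero k e)) (+-identityˡ 0#)

  -- The multiples of such an x are bounded by 1; their supremum s satisfies
  -- s ≤ s - x.
  ¬¬zero⇒nonpos : ∀ {x} → ¬ ¬ (x ≈ 0#) → x ≤ 0#
  ¬¬zero⇒nonpos {x} h = ≤-resp ([x+s]-s≈x) (-‿inverseʳ s) (+-mono-≤ (- s) (≤-resp (+-comm s x) [s-x]+x≈s (+-mono-≤ x s≤s-x)))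
    where
    P : Carrier → Set
    P z = ∃ λ k → z ≈ k · x
    bound : ∀ z → P z → z ≤ 1#
    bound z (k , e) with O.total (k · x) 1#
    ... | inj₁ p = ≤-resp (sym e) refl p
    ... | inj₂ p = ⊥-elim (h λ x≈0 → 1≰0 (≤-resp refl (·-zero k x≈0) p))
    sup : ∃ λ s → (∀ z → P z → z ≤ s) × (∀ b → (∀ z → P z → z ≤ b) → s ≤ b)
    sup = complete P (0# , 0 , refl) (1# , bound)
    s : Carrier
    s = proj₁ sup
    cancel : ∀ a b → (a + b) + - a ≈ b
    cancel a b = begin
      (a + b) + - a  ≈⟨ +-congʳ (+-comm a b) ⟩
      (b + a) + - a  ≈⟨ +-assoc b a (- a) ⟩
      b + (a + - a)  ≈⟨ +-congˡ (-‿inverseʳ a) ⟩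
      b + 0#         ≈⟨ +-identityʳ b ⟩
      b              ∎
    s≤s-x : s ≤ s + - x
    s≤s-x = proj₂ (proj₂ sup) (s + - x) λ z (k , e) →
      ≤-resp (trans (cancel x (k · x)) (sym e)) refl
        (+-mono-≤ (- x) (proj₁ (proj₂ sup) (suc k · x) (suc k , refl)))
    [x+s]-s≈x : (x + s) + - s ≈ x
    [x+s]-s≈x = trans (+-congʳ (+-comm x s)) (cancel s x)
    [s-x]+x≈s : (s + - x) + x ≈ s
    [s-x]+x≈s = begin
      (s + - x) + x  ≈⟨ +-assoc s (- x) x ⟩
      s + (- x + x)  ≈⟨ +-congˡ (-‿inverseˡ x) ⟩
      s + 0#         ≈⟨ +-identityʳ s ⟩
      s              ∎

  -- The one-sided bound is applied to `x` and to `- x`; antisymmetry then does the work of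
  -- double-negation elimination.
  zero-stable : ∀ {x} → ¬ ¬ (x ≈ 0#) → x ≈ 0#
  zero-stable {x} h = O.antisym (¬¬zero⇒nonpos h)
    (≤-resp refl (-‿involutive x) (neg-nonneg (¬¬zero⇒nonpos λ k → h λ e → k (trans (-‿cong e) -0#≈0#))))

  -- Weak excluded middle leaves a double negation, which stability removes.
  zero? : ∀ x → Dec (x ≈ 0#)
  zero? x with weak-excluded-middle (x ≈ 0#)
  ... | inj₁ ¬e = no ¬e
  ... | inj₂ ¬¬e = yes (zero-stable ¬¬e)

  *-nonzero : ∀ {x y} → ¬ (x ≈ 0#) → ¬ (y ≈ 0#) → ¬ (x * y ≈ 0#)
  *-nonzero {x} {y} x≉0 y≉0 e with inverse x x≉0
  ... | z , xz≈1 = y≉0 (begin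
    y            ≈⟨ *-identityˡ y ⟨
    1# * y       ≈⟨ *-congʳ xz≈1 ⟨
    (x * z) * y  ≈⟨ *-congʳ (*-comm x z) ⟩
    (z * x) * y  ≈⟨ *-assoc z x y ⟩
    z * (x * y)  ≈⟨ *-congˡ e ⟩
    z * 0#       ≈⟨ zeroʳ z ⟩
    0#           ∎)

-- Power series over the field

module PowerSeries (R : RealField) where
  open RealField R using (_≤_)
  open OrderedField R
  private
    module ℕ→ = Algebra.Construct.Pointwise ℕ
    open Algebra.Properties.CommutativeSemigroup (CommutativeRing.+-commutativeSemigroup commutativeRing) using (x∙yz≈y∙xz; interchange)
    open Relation.Binary.Reasoning.Setoid setoid

  Series : Set
  Series = ℕ → Carrier

  infix  4 _≋_
  infixl 6 _⊕_
  infixl 7 _⊛_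

  _≋_ : Series → Series → Set
  p ≋ q = ∀ i → p i ≈ q i

  _⊕_ : Series → Series → Series
  (p ⊕ q) i = p i + q i

  ⊖_ : Series → Series
  (⊖ p) i = - p i

  𝟘 𝟙 : Series
  𝟘 _ = 0#
  𝟙 zero    = 1#
  𝟙 (suc _) = 0#

  tail : Series → Series
  tail p i = p (suc i)

  scaled : Carrier → Series → Series
  scaled c p i = c * p i

  _⊛_ : Series → Series → Series
  (p ⊛ q) zero    = p 0 * q 0
  (p ⊛ q) (suc i) = p 0 * q (suc i) + (tail p ⊛ q) i

  ⊛-cong : ∀ {p p′ q q′} → p ≋ p′ → q ≋ q′ → p ⊛ q ≋ p′ ⊛ q′
  ⊛-cong e f zero    = *-cong (e 0) (f 0)
  ⊛-cong e f (suc i) = +-cong (*-cong (e 0) (f (suc i))) (⊛-cong (λ j → e (suc j)) f i)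

  -- The mirror image of the defining recursion, peeling the right factor; commutativity is the
  -- passage between the two.
  ⊛-sucʳ : ∀ p q i → (p ⊛ q) (suc i) ≈ p (suc i) * q 0 + (p ⊛ tail q) i
  ⊛-sucʳ p q zero    = +-comm _ _
  ⊛-sucʳ p q (suc i) = trans (+-congˡ (⊛-sucʳ (tail p) q i)) (x∙yz≈y∙xz _ _ _)

  ⊛-comm : ∀ p q → p ⊛ q ≋ q ⊛ p
  ⊛-comm p q zero    = *-comm _ _
  ⊛-comm p q (suc i) =
    trans (+-cong (*-comm _ _) (⊛-comm (tail p) q i)) (sym (⊛-sucʳ q p i))

  ⊛-distribʳ : ∀ r p q → (p ⊕ q) ⊛ r ≋ p ⊛ r ⊕ q ⊛ r
  ⊛-distribʳ r p q zero    = distribʳ _ _ _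
  ⊛-distribʳ r p q (suc i) =
    trans (+-cong (distribʳ _ _ _) (⊛-distribʳ r (tail p) (tail q) i)) (interchange _ _ _ _)

  ⊛-distribˡ : ∀ r p q → r ⊛ (p ⊕ q) ≋ r ⊛ p ⊕ r ⊛ q
  ⊛-distribˡ r p q i = begin
    (r ⊛ (p ⊕ q)) i        ≈⟨ ⊛-comm r (p ⊕ q) i ⟩
    ((p ⊕ q) ⊛ r) i        ≈⟨ ⊛-distribʳ r p q i ⟩
    (p ⊛ r) i + (q ⊛ r) i  ≈⟨ +-cong (⊛-comm p r i) (⊛-comm q r i) ⟩
    (r ⊛ p) i + (r ⊛ q) i  ∎

  scaled-⊛ : ∀ c p q → scaled c p ⊛ q ≋ scaled c (p ⊛ q)
  scaled-⊛ c p q zero    = *-assoc _ _ _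
  scaled-⊛ c p q (suc i) =
    trans (+-cong (*-assoc _ _ _) (scaled-⊛ c (tail p) q i)) (sym (distribˡ _ _ _))

  ⊛-assoc : ∀ p q r → (p ⊛ q) ⊛ r ≋ p ⊛ (q ⊛ r)
  ⊛-assoc p q r zero    = *-assoc _ _ _
  ⊛-assoc p q r (suc i) = begin
    (p 0 * q 0) * r (suc i) + ((scaled (p 0) (tail q) ⊕ tail p ⊛ q) ⊛ r) i
      ≈⟨ +-cong (*-assoc _ _ _) (⊛-distribʳ r (scaled (p 0) (tail q)) (tail p ⊛ q) i) ⟩
    p 0 * (q 0 * r (suc i)) + ((scaled (p 0) (tail q) ⊛ r) i + ((tail p ⊛ q) ⊛ r) i)
      ≈⟨ +-assoc _ _ _ ⟨
    p 0 * (q 0 * r (suc i)) + (scaled (p 0) (tail q) ⊛ r) i + ((tail p ⊛ q) ⊛ r) i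
      ≈⟨ +-cong (+-congˡ (scaled-⊛ (p 0) (tail q) r i)) (⊛-assoc (tail p) q r i) ⟩
    p 0 * (q 0 * r (suc i)) + p 0 * (tail q ⊛ r) i + (tail p ⊛ (q ⊛ r)) i
      ≈⟨ +-congʳ (distribˡ _ _ _) ⟨
    p 0 * (q 0 * r (suc i) + (tail q ⊛ r) i) + (tail p ⊛ (q ⊛ r)) i ∎

  ⊛-zeroˡ : ∀ q → 𝟘 ⊛ q ≋ 𝟘
  ⊛-zeroˡ q zero    = zeroˡ _
  ⊛-zeroˡ q (suc i) = trans (+-cong (zeroˡ _) (⊛-zeroˡ q i)) (+-identityˡ 0#)

  ⊛-identityˡ : ∀ q → 𝟙 ⊛ q ≋ q
  ⊛-identityˡ q zero    = *-identityˡ _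
  ⊛-identityˡ q (suc i) = trans (+-cong (*-identityˡ _) (⊛-zeroˡ q i)) (+-identityʳ _)

  seriesRing : CommutativeRing 0ℓ 0ℓ
  seriesRing = record
    { Carrier = Series ; _≈_ = _≋_ ; _+_ = _⊕_ ; _*_ = _⊛_ ; -_ = ⊖_ ; 0# = 𝟘 ; 1# = 𝟙
    ; isCommutativeRing = record
      { isRing = record
        { +-isAbelianGroup = ℕ→.isAbelianGroup +-isAbelianGroup
        ; *-cong = ⊛-cong
        ; *-assoc = ⊛-assoc
        ; *-identity = ⊛-identityˡ , λ q i → trans (⊛-comm q 𝟙 i) (⊛-identityˡ q i)
        ; distrib = ⊛-distribˡ , ⊛-distribʳ
        }
      ; *-comm = ⊛-comm
      }
    }

  module S = CommutativeRing seriesRing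
  open Algebra.Properties.Semiring.Sum S.semiring public using (*-distribˡ-sum)
  open Algebra.Properties.CommutativeMonoid.Sum S.+-commutativeMonoid public
    using (sum; sum-cong-≋; ∑-distrib-+; ∑-comm; sum-replicate-zero)

  -- Div m p: the series p is divisible by tᵐ.
  Div : ℕ → Series → Set
  Div m p = ∀ {i} → i < m → p i ≈ 0#

  Div-resp : ∀ {m p q} → p ≋ q → Div m p → Div m q
  Div-resp e d i<m = trans (sym (e _)) (d i<m)

  Div-mono : ∀ {m m′ p} → m ℕ.≤ m′ → Div m′ p → Div m p
  Div-mono m≤m′ d i<m = d (ℕₚ.≤-trans i<m m≤m′)

  Div-⊕ : ∀ {m p q} → Div m p → Div m q → Div m (p ⊕ q)
  Div-⊕ d e i<m = trans (+-cong (d i<m) (e i<m)) (+-identityˡ 0#)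

  Div-⊖ : ∀ {m p} → Div m p → Div m (⊖ p)
  Div-⊖ d i<m = trans (-‿cong (d i<m)) -0#≈0#
    where open import Algebra.Properties.Ring ring using (-0#≈0#)

  Div-suc : ∀ {m p} → Div m p → p m ≈ 0# → Div (suc m) p
  Div-suc {m} d e {i} (s≤s i≤m) with ℕₚ.m≤n⇒m<n∨m≡n i≤m
  ... | inj₁ i<m    = d i<m
  ... | inj₂ ≡.refl = e

  private
    dropped : ℕ → Series → Series
    dropped m p i = p (m ℕ.+ i)

    ⊛-dropped : ∀ {m p} q → Div m p → ∀ i → (p ⊛ q) (m ℕ.+ i) ≈ (dropped m p ⊛ q) i
    ⊛-dropped {zero}  q d i = refl
    ⊛-dropped {suc m} q d i =
      trans (+-cong (trans (*-congʳ (d (s≤s z≤n))) (zeroˡ _)) (⊛-dropped q (λ j<m → d (s≤s j<m)) i))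
            (+-identityˡ _)

    Div-⊛ˡ : ∀ {m p} q → Div m p → Div m (p ⊛ q)
    Div-⊛ˡ q d {zero}  (s≤s _)   = trans (*-congʳ (d (s≤s z≤n))) (zeroˡ _)
    Div-⊛ˡ q d {suc i} (s≤s i<m) =
      trans (+-cong (trans (*-congʳ (d (s≤s z≤n))) (zeroˡ _)) (Div-⊛ˡ q (λ j<m → d (s≤s j<m)) i<m))
            (+-identityˡ 0#)

  -- Dividing both factors by their powers of `t` turns this coefficient into a product of constant
  -- terms.
  ⊛-lead : ∀ {k m p q} → Div k p → Div m q → (p ⊛ q) (k ℕ.+ m) ≈ p k * q m
  ⊛-lead {k} {m} {p} {q} d e = begin
    (p ⊛ q) (k ℕ.+ m)                ≈⟨ ⊛-dropped q d m ⟩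
    (dropped k p ⊛ q) m              ≈⟨ ⊛-comm (dropped k p) q m ⟩
    (q ⊛ dropped k p) m              ≡⟨ ≡.cong (q ⊛ dropped k p) (ℕₚ.+-identityʳ m) ⟨
    (q ⊛ dropped k p) (m ℕ.+ 0)      ≈⟨ ⊛-dropped (dropped k p) e 0 ⟩
    q (m ℕ.+ 0) * p (k ℕ.+ 0)        ≡⟨ ≡.cong₂ (λ i j → q i * p j) (ℕₚ.+-identityʳ m) (ℕₚ.+-identityʳ k) ⟩
    q m * p k                        ≈⟨ *-comm _ _ ⟩
    p k * q m                        ∎

  Div-⊛ : ∀ {k m p q} → Div k p → Div m q → Div (k ℕ.+ m) (p ⊛ q)
  Div-⊛ {k} {m} {p} {q} d e {i} i<k+m with i ℕ.<? k
  ... | yes i<k = Div-⊛ˡ q d i<k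
  ... | no  i≮k = begin
    (p ⊛ q) i                 ≡⟨ ≡.cong (p ⊛ q) (ℕₚ.m+[n∸m]≡n k≤i) ⟨
    (p ⊛ q) (k ℕ.+ (i ℕ.∸ k)) ≈⟨ ⊛-dropped q d (i ℕ.∸ k) ⟩
    (dropped k p ⊛ q) (i ℕ.∸ k) ≈⟨ ⊛-comm (dropped k p) q (i ℕ.∸ k) ⟩
    (q ⊛ dropped k p) (i ℕ.∸ k) ≈⟨ Div-⊛ˡ (dropped k p) e i∸k<m ⟩
    0#                        ∎
    where
    k≤i : k ℕ.≤ i
    k≤i = ℕₚ.≮⇒≥ i≮k
    i∸k<m : i ℕ.∸ k < m
    i∸k<m = ℕₚ.+-cancelˡ-< k _ _ (≡.subst (_< k ℕ.+ m) (≡.sym (ℕₚ.m+[n∸m]≡n k≤i)) i<k+m)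

  Order : Series → ℕ → Set
  Order p k = Div k p × ¬ (p k ≈ 0#)

  order-max : ∀ {p k m} → Order p k → Div m p → m ℕ.≤ k
  order-max {p} {k} {m} (_ , p≉0) d = ℕₚ.≮⇒≥ λ k<m → p≉0 (d k<m)

  order-unique : ∀ {p k m} → Order p k → Order p m → k ≡ m
  order-unique o o′ = ℕₚ.≤-antisym (order-max o′ (proj₁ o)) (order-max o (proj₁ o′))

  order-⊛ : ∀ {p q k m} → Order p k → Order q m → Order (p ⊛ q) (k ℕ.+ m)
  order-⊛ (d , p≉0) (e , q≉0) = Div-⊛ d e , λ z → *-nonzero p≉0 q≉0 (trans (sym (⊛-lead d e)) z)

  order-⊕ : ∀ {p q k} → Order p k → Div (suc k) q → Order (p ⊕ q) k
  order-⊕ {p} {q} {k} (d , p≉0) e = Div-⊕ d (Div-mono (ℕₚ.n≤1+n k) e) , λ z → p≉0 (begin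
    p k        ≈⟨ +-identityʳ _ ⟨
    p k + 0#   ≈⟨ +-congˡ (e ℕₚ.≤-refl) ⟨
    p k + q k  ≈⟨ z ⟩
    0#         ∎)

  order-⊖ : ∀ {p k} → Order p k → Order (⊖ p) k
  order-⊖ {p} {k} (d , p≉0) = Div-⊖ d , λ z → p≉0 (begin
      p k        ≈⟨ -‿involutive _ ⟨
      - - p k    ≈⟨ -‿cong z ⟩
      - 0#       ≈⟨ -0#≈0# ⟩
      0#         ∎)
    where open import Algebra.Properties.Ring ring using (-0#≈0#; -‿involutive)

  order-resp : ∀ {p q k} → p ≋ q → Order p k → Order q k
  order-resp e (d , p≉0) = Div-resp e d , λ z → p≉0 (trans (e _) z)

  -- A bounded search: testing finitely many coefficients cannot tell whether a series is zero, so
  -- the order is sought only below `m`.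
  order-or-divisible : ∀ p m → ∃ (Order p) ⊎ Div m p
  order-or-divisible p zero    = inj₂ λ ()
  order-or-divisible p (suc m) with order-or-divisible p m
  ... | inj₁ o = inj₁ o
  ... | inj₂ d with zero? (p m)
  ...   | yes e = inj₂ (Div-suc d e)
  ...   | no ¬e = inj₁ (m , d , ¬e)

  -- A nonnegative germ vanishes or has its lowest term at an even exponent with
  -- positive coefficient; sums of such series cannot cancel.
  record NonNegGerm (p : Series) : Set where
    constructor nonNegGerm
    field
      lead-nonneg : ∀ {m} → Div m p → 0# ≤ p m
      even-order  : ∀ j → Div (suc (j ℕ.+ j)) p → Div (suc (suc (j ℕ.+ j))) p
  open NonNegGerm public

  germ-resp : ∀ {p q} → p ≋ q → NonNegGerm p → NonNegGerm q
  germ-resp e g = nonNegGerm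
    (λ d → ≤-resp refl (e _) (lead-nonneg g (Div-resp (λ i → sym (e i)) d)))
    (λ j d → Div-resp e (even-order g j (Div-resp (λ i → sym (e i)) d)))

  germ-𝟘 : NonNegGerm 𝟘
  germ-𝟘 = nonNegGerm (λ _ → ≤-resp refl (zeroˡ 0#) (square-nonneg 0#)) (λ _ _ _ → refl)

  -- The exponent is raised one at a time: once both summands are divisible by tᵐ, their
  -- coefficients at `m` are nonnegative with sum zero, so both vanish.
  germ-summandˡ : ∀ {p q} → NonNegGerm p → NonNegGerm q → ∀ m → Div m (p ⊕ q) → Div m p
  germ-summandʳ : ∀ {p q} → NonNegGerm p → NonNegGerm q → ∀ m → Div m (p ⊕ q) → Div m q

  germ-summandˡ g h zero    d ()
  germ-summandˡ g h (suc m) d = Div-suc dp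
    (sum-zeroˡ (lead-nonneg g dp) (lead-nonneg h dq) (d ℕₚ.≤-refl))
    where
    d′ = Div-mono (ℕₚ.n≤1+n m) d
    dp = germ-summandˡ g h m d′
    dq = germ-summandʳ g h m d′

  germ-summandʳ {p} {q} g h m d =
    germ-summandˡ h g m (Div-resp (λ i → +-comm (p i) (q i)) d)

  germ-⊕ : ∀ {p q} → NonNegGerm p → NonNegGerm q → NonNegGerm (p ⊕ q)
  germ-⊕ g h = nonNegGerm
    (λ {m} d → +-nonneg (lead-nonneg g (germ-summandˡ g h m d)) (lead-nonneg h (germ-summandʳ g h m d)))
    (λ j d → Div-⊕ (even-order g j (germ-summandˡ g h _ d)) (even-order h j (germ-summandʳ g h _ d)))

  germ-sum : ∀ {n} (T : Fin n → Series) → (∀ c → NonNegGerm (T c)) → NonNegGerm (sum T)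
  germ-sum {zero}  T g = germ-𝟘
  germ-sum {suc n} T g = germ-⊕ (g zero) (germ-sum (λ c → T (suc c)) λ c → g (suc c))

  germ-term : ∀ {n} (T : Fin n → Series) → (∀ c → NonNegGerm (T c)) →
              ∀ {m} → Div m (sum T) → ∀ c → Div m (T c)
  germ-term {suc n} T g {m} d zero =
    germ-summandˡ (g zero) (germ-sum (λ c → T (suc c)) λ c → g (suc c)) m d
  germ-term {suc n} T g {m} d (suc c) =
    germ-term (λ c → T (suc c)) (λ c → g (suc c))
      (germ-summandʳ (g zero) (germ-sum (λ c → T (suc c)) λ c → g (suc c)) m d) c

  -- Once `p` is divisible by tʲ, the coefficient of `p ⊛ p` at `j + j` is the square of the
  -- coefficient of `p` at `j`.
  square-root-div : ∀ {p} j → Div (suc (j ℕ.+ j)) (p ⊛ p) → Div (suc j) p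
  square-root-div {p} j d = Div-suc dp (zero-root (trans (sym (⊛-lead dp dp)) (d ℕₚ.≤-refl)))
    where
    zero-root : ∀ {x} → x * x ≈ 0# → x ≈ 0#
    zero-root {x} e with zero? x
    ... | yes x≈0 = x≈0
    ... | no  x≉0 = ⊥-elim (*-nonzero x≉0 x≉0 e)
    dp : Div j p
    dp = previous j d
      where
      previous : ∀ j → Div (suc (j ℕ.+ j)) (p ⊛ p) → Div j p
      previous zero    d ()
      previous (suc i) d = square-root-div i (Div-mono (ℕₚ.m≤n⇒m≤1+n (s≤s (ℕₚ.+-monoʳ-≤ i (ℕₚ.n≤1+n i)))) d)

  germ-square : ∀ p → NonNegGerm (p ⊛ p)
  germ-square p = nonNegGerm lead even
    where
    even : ∀ j → Div (suc (j ℕ.+ j)) (p ⊛ p) → Div (suc (suc (j ℕ.+ j))) (p ⊛ p)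
    even j d = ≡.subst (λ m → Div m (p ⊛ p)) (≡.cong suc (ℕₚ.+-suc j j)) (Div-⊛ r r)
      where r = square-root-div j d
    lead : ∀ {m} → Div m (p ⊛ p) → 0# ≤ (p ⊛ p) m
    lead {m} d with parity m
      where
      parity : ∀ m → ∃ λ j → m ≡ j ℕ.+ j ⊎ m ≡ suc (j ℕ.+ j)
      parity zero    = 0 , inj₁ ≡.refl
      parity (suc m) with parity m
      ... | j , inj₁ e = j , inj₂ (≡.cong suc e)
      ... | j , inj₂ e = suc j , inj₁ (≡.trans (≡.cong suc e) (≡.cong suc (≡.sym (ℕₚ.+-suc j j))))
    -- For odd `m` the coefficient vanishes by evenness; for even `m` it is the square of a
    -- coefficient of `p`.
    ... | j , inj₂ ≡.refl = ≤-resp refl (sym (even j d ℕₚ.≤-refl)) (lead-nonneg germ-𝟘 {0} λ ())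
    ... | zero , inj₁ ≡.refl = square-nonneg (p 0)
    ... | suc j , inj₁ ≡.refl = ≤-resp refl (sym (⊛-lead r r)) (square-nonneg (p (suc j)))
      where r = square-root-div j (Div-mono (s≤s (ℕₚ.+-monoʳ-≤ j (ℕₚ.n≤1+n j))) d)

-- Vertex sets, deletion and neighbours

∈⇒lookup : ∀ {n} {S : Subset n} {c} → c ∈ S → lookup S c ≡ true
∈⇒lookup = Vecₚ.[]=⇒lookup

lookup⇒∈ : ∀ {n} {S : Subset n} {c} → lookup S c ≡ true → c ∈ S
lookup⇒∈ {S = S} {c} = Vecₚ.lookup⇒[]= c S

lookup-minus-self : ∀ {n} (S : Subset n) u → lookup (S - u) u ≡ false
lookup-minus-self (true  ∷ S) zero    = ≡.refl
lookup-minus-self (false ∷ S) zero    = ≡.refl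
lookup-minus-self (true  ∷ S) (suc u) = lookup-minus-self S u
lookup-minus-self (false ∷ S) (suc u) = lookup-minus-self S u

lookup-minus : ∀ {n} (S : Subset n) {u c} → c ≢ u → lookup (S - u) c ≡ lookup S c
lookup-minus (_ ∷ S) {zero}  {zero}  c≢u = ⊥-elim (c≢u ≡.refl)
lookup-minus (_ ∷ S) {suc u} {zero}  c≢u = ≡.refl
lookup-minus (_ ∷ S) {zero}  {suc c} c≢u = ≡.cong (λ T → lookup T c) (Subₚ.p─⊥≡p S)
lookup-minus (_ ∷ S) {suc u} {suc c} c≢u = lookup-minus S λ e → c≢u (≡.cong suc e)

∈-minus⁻ : ∀ {n} {S : Subset n} {u c} → c ∈ S - u → c ∈ S × c ≢ u
∈-minus⁻ {S = S} {u} {c} c∈ = c∈S , c≢u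
  where
  c≢u : c ≢ u
  c≢u ≡.refl with () ← ≡.trans (≡.sym (lookup-minus-self S u)) (∈⇒lookup c∈)
  c∈S : c ∈ S
  c∈S = lookup⇒∈ (≡.trans (≡.sym (lookup-minus S c≢u)) (∈⇒lookup c∈))

∈-minus⁺ : ∀ {n} {S : Subset n} {u c} → c ∈ S → c ≢ u → c ∈ S - u
∈-minus⁺ = Subₚ.x∈p∧x≢y⇒x∈p-y

minus-comm : ∀ {n} (S : Subset n) u v → S - u - v ≡ S - v - u
minus-comm = Subₚ.p─x─y≡p─y─x

∣minus∣ : ∀ {n} {S : Subset n} {u} → u ∈ S → ∣ S ∣ ≡ suc ∣ S - u ∣
∣minus∣ {S = _ ∷ S}     here       = ≡.cong (λ T → suc ∣ T ∣) (≡.sym (Subₚ.p─⊥≡p S))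
∣minus∣ {S = true ∷ S}  (there u∈) = ≡.cong suc (∣minus∣ u∈)
∣minus∣ {S = false ∷ S} (there u∈) = ∣minus∣ u∈

─⁻ : ∀ {n} {p q : Subset n} {x} → x ∈ p ─ q → x ∈ p × x ∉ q
─⁻ {p = p} {q} x∈ = Subₚ.p─q⊆p p q x∈ , λ x∈q → disjoint x∈ x∈q
  where
  disjoint : ∀ {n} {p q : Subset n} {x} → x ∈ p ─ q → x ∉ q
  disjoint {p = _ ∷ _} {false ∷ _} here       ()
  disjoint {p = _ ∷ _} {true  ∷ _} ()         here
  disjoint {p = _ ∷ _} {_ ∷ _}     (there x∈) (there x∈q) = disjoint x∈ x∈q

minus-─-minus : ∀ {n} (S : Subset n) {A a} → a ∈ A → (S - a) ─ (A - a) ≡ S ─ A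
minus-─-minus S {A} {a} a∈A = Subₚ.⊆-antisym to from
  where
  to : (S - a) ─ (A - a) ⊆ S ─ A
  to x∈ with ─⁻ x∈
  ... | x∈S-a , x∉A-a with ∈-minus⁻ x∈S-a
  ...   | x∈S , x≢a = Subₚ.x∈p∧x∉q⇒x∈p─q x∈S λ x∈A → x∉A-a (∈-minus⁺ x∈A x≢a)
  from : S ─ A ⊆ (S - a) ─ (A - a)
  from x∈ with ─⁻ x∈
  ... | x∈S , x∉A = Subₚ.x∈p∧x∉q⇒x∈p─q (∈-minus⁺ x∈S λ { ≡.refl → x∉A a∈A }) λ x∈A-a → x∉A (proj₁ (∈-minus⁻ x∈A-a))

module Links {n : ℕ} (G : Graph n) where

  link : Subset n → Fin n → Fin n → Bool
  link S u c = lookup (S - u) c ∧ adj G u c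

  link⁺ : ∀ {S u c} → c ∈ S - u → adj G u c ≡ true → link S u c ≡ true
  link⁺ {S} {u} {c} c∈ e rewrite ∈⇒lookup c∈ = e

  link⁻ : ∀ {S u c} → link S u c ≡ true → c ∈ S - u × adj G u c ≡ true
  link⁻ {S} {u} {c} e with lookup (S - u) c in m
  ... | true = lookup⇒∈ m , e

  link-minus : ∀ S u v {c} → c ≢ v → link (S - v) u c ≡ link S u c
  link-minus S u v {c} c≢v = ≡.cong (_∧ adj G u c)
    (≡.trans (≡.cong (λ T → lookup T c) (minus-comm S v u)) (lookup-minus (S - u) c≢v))

  link-minus-self : ∀ S u v → link (S - v) u v ≡ false
  link-minus-self S u v = ≡.cong (_∧ adj G u v)
    (≡.trans (≡.cong (λ T → lookup T v) (minus-comm S v u)) (lookup-minus-self (S - u) v))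

-- Sums of series over vertices

module SeriesSums (R : RealField) where
  open OrderedField R
  open PowerSeries R
  open Algebra.Properties.Ring S.ring using (-0#≈0#; -‿+-comm)
  open Algebra.Properties.CommutativeSemigroup (CommutativeRing.+-commutativeSemigroup seriesRing) using (x∙yz≈y∙xz)
  open Relation.Binary.Reasoning.Setoid S.setoid

  -- Sums always run over all of `Fin n`; switching off the absent vertices lets sums over different
  -- sets be compared termwise.
  on : Bool → Series → Series
  on true  p = p
  on false p = 𝟘

  on-cong : ∀ b {p q} → p ≋ q → on b p ≋ on b q
  on-cong true  e = e
  on-cong false e = S.refl

  on-𝟘 : ∀ b → on b 𝟘 ≋ 𝟘
  on-𝟘 true  = S.refl
  on-𝟘 false = S.refl

  on-swap : ∀ a b p → on a (on b p) ≋ on b (on a p)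
  on-swap true  b     p = S.refl
  on-swap false true  p = S.refl
  on-swap false false p = S.refl

  on-⊕ : ∀ b p q → on b (p ⊕ q) ≋ on b p ⊕ on b q
  on-⊕ true  p q = S.refl
  on-⊕ false p q = S.sym (S.+-identityˡ 𝟘)

  on-⊛ : ∀ b p q → on b (p ⊛ q) ≋ p ⊛ on b q
  on-⊛ true  p q = S.refl
  on-⊛ false p q = S.sym (S.zeroʳ p)

  sum-zero : ∀ {n} {h : Fin n → Series} → (∀ c → h c ≋ 𝟘) → sum h ≋ 𝟘
  sum-zero {n} e = S.trans (sum-cong-≋ e) (sum-replicate-zero n)

  on-sum : ∀ b {n} (h : Fin n → Series) → on b (sum h) ≋ sum (λ c → on b (h c))
  on-sum true      h = S.refl
  on-sum false {n} h = S.sym (sum-zero {n} λ _ → S.refl)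

  ⊖-sum : ∀ {n} (h : Fin n → Series) → ⊖ sum h ≋ sum (λ c → ⊖ h c)
  ⊖-sum {zero}  h = -0#≈0#
  ⊖-sum {suc n} h = S.trans (S.sym (-‿+-comm _ _)) (S.+-congˡ (⊖-sum (λ c → h (suc c))))

  sum-difference : ∀ {n} p q (a b : Fin n → Series) →
    p ⊛ sum a ⊕ ⊖ (q ⊛ sum b) ≋ sum (λ c → p ⊛ a c ⊕ ⊖ (q ⊛ b c))
  sum-difference p q a b = begin
    p ⊛ sum a ⊕ ⊖ (q ⊛ sum b)
      ≈⟨ S.+-cong (*-distribˡ-sum p a) (S.-‿cong (*-distribˡ-sum q b)) ⟩
    sum (λ c → p ⊛ a c) ⊕ ⊖ sum (λ c → q ⊛ b c)
      ≈⟨ S.+-congˡ (⊖-sum (λ c → q ⊛ b c)) ⟩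
    sum (λ c → p ⊛ a c) ⊕ sum (λ c → ⊖ (q ⊛ b c))
      ≈⟨ ∑-distrib-+ (λ c → p ⊛ a c) (λ c → ⊖ (q ⊛ b c)) ⟨
    sum (λ c → p ⊛ a c ⊕ ⊖ (q ⊛ b c)) ∎

  sum-split : ∀ {n} (u : Fin n) {x} (h h′ : Fin n → Series) → h u ≋ x ⊕ h′ u →
              (∀ c → c ≢ u → h c ≋ h′ c) → sum h ≋ x ⊕ sum h′
  sum-split zero h h′ e es =
    S.trans (S.+-cong e (sum-cong-≋ λ c → es (suc c) λ ())) (S.+-assoc _ _ _)
  sum-split (suc u) h h′ e es =
    S.trans (S.+-cong (es zero λ ()) (sum-split u (λ c → h (suc c)) (λ c → h′ (suc c)) e
              λ c c≢u → es (suc c) λ { ≡.refl → c≢u ≡.refl }))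
            (x∙yz≈y∙xz _ _ _)

  Div-sum : ∀ {n m} (h : Fin n → Series) → (∀ c → Div m (h c)) → Div m (sum h)
  Div-sum {zero}  h d _ = refl
  Div-sum {suc n} h d = Div-⊕ (d zero) (Div-sum (λ c → h (suc c)) λ c → d (suc c))

  difference : ∀ {a b c d} → a ⊕ b ≋ c ⊕ d → a ⊕ ⊖ c ≋ d ⊕ ⊖ b
  difference {a} {b} {c} {d} e = begin
    a ⊕ ⊖ c                ≈⟨ S.+-congʳ (move a b) ⟩
    a ⊕ b ⊕ ⊖ b ⊕ ⊖ c      ≈⟨ S.+-congʳ (S.+-congʳ e) ⟩
    c ⊕ d ⊕ ⊖ b ⊕ ⊖ c      ≈⟨ S.+-congʳ (S.+-assoc c d (⊖ b)) ⟩
    c ⊕ (d ⊕ ⊖ b) ⊕ ⊖ c    ≈⟨ S.+-congʳ (S.+-comm c _) ⟩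
    d ⊕ ⊖ b ⊕ c ⊕ ⊖ c      ≈⟨ move (d ⊕ ⊖ b) c ⟨
    d ⊕ ⊖ b                ∎
    where
    move : ∀ x y → x ≋ x ⊕ y ⊕ ⊖ y
    move x y = S.sym (S.trans (S.+-assoc x y (⊖ y)) (S.trans (S.+-congˡ (S.-‿inverseʳ y)) (S.+-identityʳ x)))

  zero-difference : ∀ p q → p ⊛ 𝟘 ⊕ ⊖ (q ⊛ 𝟘) ≋ 𝟘
  zero-difference p q = S.trans (S.+-cong (S.zeroʳ p) (S.trans (S.-‿cong (S.zeroʳ q)) -0#≈0#)) (S.+-identityˡ 𝟘)

  square-difference : ∀ p q → p ⊛ p ⊕ ⊖ (q ⊛ 𝟘) ≋ p ⊛ p
  square-difference p q = S.trans (S.+-congˡ (S.trans (S.-‿cong (S.zeroʳ q)) -0#≈0#)) (S.+-identityʳ _)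

-- The vertex recurrence and the path identity

module Families (R : RealField) {n : ℕ} (G : Graph n) where
  open OrderedField R
  open PowerSeries R
  open SeriesSums R
  open Links G public
  open Algebra.Properties.CommutativeSemigroup (CommutativeRing.+-commutativeSemigroup seriesRing) using (interchange)
  open Relation.Binary.Reasoning.Setoid S.setoid

  links : (Subset n → Series) → Subset n → Fin n → Fin n → Series
  links f S u c = on (link S u c) (f (S - u - c))

  -- The recurrence f(S) = X(u) f(S-u) - Σ f(S-u-c) over the neighbours c of u, with the sum moved
  -- to the left. The weight may depend on the vertex, which makes room for loops.
  Family : (Fin n → Series) → (Subset n → Series) → Set
  Family X f = ∀ S u → u ∈ S → f S ⊕ sum (links f S u) ≋ X u ⊛ f (S - u)

  -- Deleting `v` before or after `u`, `c` leaves the same set, so only the guards must agree; for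
  -- `c = v` both sides are switched off. This exchange serves both the loop construction and the
  -- derivative formula.
  links-swap : ∀ f S u v c →
    on (lookup (S - u) v) (links f (S - v) u c) ≋ on (link S u c) (on (lookup (S - u - c) v) (f (S - u - c - v)))
  links-swap f S u v c with c ≟ v
  ... | yes ≡.refl rewrite link-minus-self S u v | lookup-minus-self (S - u) v =
    S.trans (on-𝟘 (lookup (S - u) v)) (S.sym (on-𝟘 (link S u v)))
  ... | no c≢v rewrite link-minus S u v c≢v | lookup-minus (S - u) {c} {v} (λ e → c≢v (≡.sym e))
                     | minus-comm S v u | minus-comm (S - u) v c =
    on-swap (lookup (S - u) v) (link S u c) (f (S - u - c - v))

  Δ : (Subset n → Series) → Subset n → Fin n → Fin n → Series
  Δ f S u v = f (S - u) ⊛ f (S - v) ⊕ ⊖ (f S ⊛ f (S - u - v))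

  module _ {X f} (fam : Family X f) where

    -- The part of Δ f S u v contributed by the paths from u to v that start with u, c.
    step : Subset n → Fin n → Fin n → Fin n → Series
    step S u v c = f (S - u - v) ⊛ links f S u c ⊕ ⊖ (f (S - u) ⊛ links f (S - v) u c)

    -- The recurrence at `u` in `S`, times `f (S - u - v)`, and the one at `u` in `S - v`, times
    -- `f (S - u)`, have the same right-hand side. Subtracting them eliminates the weight.
    Δ-expand : ∀ {S u v} → u ∈ S → u ≢ v → Δ f S u v ≋ sum (step S u v)
    Δ-expand {S} {u} {v} u∈S u≢v =
      S.trans (difference cross) (sum-difference (f (S - u - v)) (f (S - u)) (links f S u) (links f (S - v) u))
      where
      fu fv fuv A B : Series
      fu = f (S - u)
      fv = f (S - v)
      fuv = f (S - u - v)
      A = sum (links f S u)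
      B = sum (links f (S - v) u)
      fv-rec : fv ⊕ B ≋ X u ⊛ fuv
      fv-rec = S.trans (fam (S - v) u (∈-minus⁺ u∈S u≢v)) (S.*-congˡ (S.reflexive (≡.cong f (minus-comm S v u))))
      cross : fu ⊛ fv ⊕ fu ⊛ B ≋ f S ⊛ fuv ⊕ fuv ⊛ A
      cross = begin
        fu ⊛ fv ⊕ fu ⊛ B        ≈⟨ S.distribˡ fu fv B ⟨
        fu ⊛ (fv ⊕ B)           ≈⟨ S.*-congˡ fv-rec ⟩
        fu ⊛ (X u ⊛ fuv)        ≈⟨ S.*-assoc fu (X u) fuv ⟨
        fu ⊛ X u ⊛ fuv          ≈⟨ S.*-congʳ (S.*-comm fu (X u)) ⟩
        X u ⊛ fu ⊛ fuv          ≈⟨ S.*-congʳ (fam S u u∈S) ⟨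
        (f S ⊕ A) ⊛ fuv         ≈⟨ S.distribʳ fuv (f S) A ⟩
        f S ⊛ fuv ⊕ A ⊛ fuv     ≈⟨ S.+-congˡ (S.*-comm A fuv) ⟩
        f S ⊛ fuv ⊕ fuv ⊛ A     ∎

    step-final : ∀ {S u v} → link S u v ≡ true → step S u v v ≋ f (S - u - v) ⊛ f (S - u - v)
    step-final {S} {u} {v} e rewrite e | link-minus-self S u v = square-difference _ _

    -- After the edge from `u` to `c`, the rest of the path runs from `c` to `v` and avoids `u`.
    step-inner : ∀ {S u v c} → link S u c ≡ true → c ≢ v → step S u v c ≋ Δ f (S - u) c v
    step-inner {S} {u} {v} {c} e c≢v rewrite link-minus S u v c≢v | e | minus-comm S v u | minus-comm (S - u) v c =
      S.+-congʳ (S.*-comm _ _)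

    step-absent : ∀ {S u v c} → link S u c ≡ false → step S u v c ≋ 𝟘
    step-absent {S} {u} {v} {c} e with c ≟ v
    ... | yes ≡.refl rewrite e | link-minus-self S u v = zero-difference _ _
    ... | no c≢v rewrite link-minus S u v c≢v | e = zero-difference _ _

    -- Induction on a bound for the size of `S`: every step is zero, a square, or a `Δ` on the
    -- smaller set `S - u`.
    germ-Δ : ∀ k {S u v} → ∣ S ∣ < k → u ∈ S → v ∈ S → u ≢ v → NonNegGerm (Δ f S u v)
    germ-step : ∀ k {S u v} → ∣ S ∣ < suc k → u ∈ S → v ∈ S → u ≢ v → ∀ c → NonNegGerm (step S u v c)

    germ-Δ (suc k) s u∈S v∈S u≢v =
      germ-resp (S.sym (Δ-expand u∈S u≢v)) (germ-sum _ (germ-step k s u∈S v∈S u≢v))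

    germ-step k {S} {u} {v} s u∈S v∈S u≢v c = by-link (link S u c) ≡.refl
      where
      by-link : ∀ b → link S u c ≡ b → NonNegGerm (step S u v c)
      by-link false e = germ-resp (S.sym (step-absent e)) germ-𝟘
      by-link true  e with c ≟ v
      ... | yes ≡.refl = germ-resp (S.sym (step-final e)) (germ-square _)
      ... | no c≢v = germ-resp (S.sym (step-inner e c≢v))
        (germ-Δ k (ℕₚ.<-≤-trans (Subₚ.x∈p⇒∣p-x∣<∣p∣ u∈S) (ℕ.s≤s⁻¹ s)) (proj₁ (link⁻ e))
                  (∈-minus⁺ v∈S λ v≡u → u≢v (≡.sym v≡u)) c≢v)

    Δ-step : ∀ {S u v m} → u ∈ S → v ∈ S → u ≢ v → Div m (Δ f S u v) → ∀ c → Div m (step S u v c)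
    Δ-step {S} u∈S v∈S u≢v d =
      germ-term _ (germ-step ∣ S ∣ ℕₚ.≤-refl u∈S v∈S u≢v) (Div-resp (Δ-expand u∈S u≢v) d)

    Δ-edge : ∀ {S u v m} → u ∈ S → v ∈ S → u ≢ v → adj G u v ≡ true →
             Div m (Δ f S u v) → Div m (f (S - u - v) ⊛ f (S - u - v))
    Δ-edge {v = v} u∈S v∈S u≢v e d =
      Div-resp (step-final (link⁺ (∈-minus⁺ v∈S λ v≡u → u≢v (≡.sym v≡u)) e)) (Δ-step u∈S v∈S u≢v d v)

    Δ-neighbour : ∀ {S u v c m} → u ∈ S → v ∈ S → u ≢ v → c ∈ S - u → c ≢ v → adj G u c ≡ true →
                  Div m (Δ f S u v) → Div m (Δ f (S - u) c v)
    Δ-neighbour {c = c} u∈S v∈S u≢v c∈ c≢v e d =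
      Div-resp (step-inner (link⁺ c∈ e) c≢v) (Δ-step u∈S v∈S u≢v d c)

    Δ-even : ∀ {S u v} j → u ∈ S → v ∈ S → u ≢ v →
             Div (suc (j ℕ.+ j)) (Δ f S u v) → Div (suc (suc (j ℕ.+ j))) (Δ f S u v)
    Δ-even {S} j u∈S v∈S u≢v = even-order (germ-Δ (suc ∣ S ∣) ℕₚ.≤-refl u∈S v∈S u≢v) j

    -- Putting a loop at w adds f (S - w) to f S.
    looped : Fin n → Subset n → Series
    looped w S = f S ⊕ on (lookup S w) (f (S - w))

    -- In the recurrence the loop only adds 1 to the weight of `w`, and weights cancel in `Δ`; so
    -- all parity statements hold for the looped family too.
    looped-weight : Fin n → Fin n → Series
    looped-weight w u = X u ⊕ on (does (u ≟ w)) 𝟙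

    looped-family : ∀ w → Family (looped-weight w) (looped w)
    looped-family w S u u∈S with u ≟ w
    -- Deleting `w` deletes its loop, so no later term is altered and the extra `f (S - w)` goes
    -- into the weight.
    ... | yes ≡.refl = begin
      looped w S ⊕ sum (links (looped w) S w)
        ≈⟨ S.+-cong (S.+-congˡ (S.reflexive (≡.cong (λ b → on b (f (S - w))) (∈⇒lookup u∈S))))
                    (sum-cong-≋ λ c → on-cong (link S w c) (S.trans (S.+-congˡ (S.reflexive
                      (≡.cong (λ b → on b (f (S - w - c - w))) (w-absent c)))) (S.+-identityʳ _))) ⟩
      f S ⊕ f (S - w) ⊕ sum (links f S w)
        ≈⟨ S.trans (S.+-assoc _ _ _) (S.trans (S.+-congˡ (S.+-comm _ _)) (S.sym (S.+-assoc _ _ _))) ⟩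
      f S ⊕ sum (links f S w) ⊕ f (S - w)
        ≈⟨ S.+-cong (fam S w u∈S) (S.sym (S.*-identityˡ (f (S - w)))) ⟩
      X w ⊛ f (S - w) ⊕ 𝟙 ⊛ f (S - w)
        ≈⟨ S.distribʳ (f (S - w)) (X w) 𝟙 ⟨
      (X w ⊕ 𝟙) ⊛ f (S - w)
        ≈⟨ S.*-congˡ (S.trans (S.+-congˡ (S.reflexive (≡.cong (λ b → on b (f (S - w - w))) (lookup-minus-self S w)))) (S.+-identityʳ _)) ⟨
      (X w ⊕ 𝟙) ⊛ looped w (S - w) ∎
      where
      w-absent : ∀ c → lookup (S - w - c) w ≡ false
      w-absent c = ≡.trans (≡.cong (λ T → lookup T w) (minus-comm S w c)) (lookup-minus-self (S - c) w)
    -- This is the sum of the recurrences at `u` in `S` and in `S - w`, the second present only if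
    -- `w` lies in `S`.
    ... | no u≢w = begin
      looped w S ⊕ sum (links (looped w) S u)
        ≈⟨ S.+-congˡ (S.trans (sum-cong-≋ λ c → on-⊕ (link S u c) _ _) (∑-distrib-+ (links f S u) _)) ⟩
      f S ⊕ on (lookup S w) (f (S - w)) ⊕ (sum (links f S u) ⊕ sum (λ c → on (link S u c) (on (lookup (S - u - c) w) (f (S - u - c - w)))))
        ≈⟨ interchange _ _ _ _ ⟩
      f S ⊕ sum (links f S u) ⊕ (on (lookup S w) (f (S - w)) ⊕ sum (λ c → on (link S u c) (on (lookup (S - u - c) w) (f (S - u - c - w)))))
        ≈⟨ S.+-cong (fam S u u∈S) (S.+-congˡ (sum-cong-≋ λ c → S.trans (S.sym (links-swap f S u w c))
              (S.reflexive (≡.cong (λ b → on b (links f (S - w) u c)) w-same)))) ⟩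
      X u ⊛ f (S - u) ⊕ (on (lookup S w) (f (S - w)) ⊕ sum (λ c → on (lookup S w) (links f (S - w) u c)))
        ≈⟨ S.+-congˡ (S.trans (S.+-congˡ (S.sym (on-sum (lookup S w) (links f (S - w) u)))) (S.sym (on-⊕ (lookup S w) _ _))) ⟩
      X u ⊛ f (S - u) ⊕ on (lookup S w) (f (S - w) ⊕ sum (links f (S - w) u))
        ≈⟨ S.+-congˡ (S.trans (on-cong (lookup S w) (fam (S - w) u (∈-minus⁺ u∈S u≢w))) (on-⊛ (lookup S w) _ _)) ⟩
      X u ⊛ f (S - u) ⊕ X u ⊛ on (lookup S w) (f (S - w - u))
        ≈⟨ S.distribˡ (X u) _ _ ⟨
      X u ⊛ (f (S - u) ⊕ on (lookup S w) (f (S - w - u)))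
        ≈⟨ S.*-cong (S.sym (S.+-identityʳ (X u))) (S.+-congˡ (S.reflexive (≡.cong₂ (λ b T → on b (f T)) (≡.sym w-same) (minus-comm S w u)))) ⟩
      (X u ⊕ 𝟘) ⊛ looped w (S - u) ∎
      where
      w-same : lookup (S - u) w ≡ lookup S w
      w-same = lookup-minus S λ w≡u → u≢w (≡.sym w≡u)

-- Formal differentiation in t

module Derivative (R : RealField) (θ : RealField.Carrier R) where
  open OrderedField R
  open PowerSeries R
  open SeriesSums R
  open Algebra.Properties.Semiring.Mult semiring using (×-comm-*)
  open Algebra.Properties.CommutativeSemigroup (CommutativeRing.+-commutativeSemigroup commutativeRing) using (x∙yz≈y∙xz)
  open Relation.Binary.Reasoning.Setoid setoid

  -- The indeterminate x = θ + t.
  var : Series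
  var zero          = θ
  var (suc zero)    = 1#
  var (suc (suc _)) = 0#

  var-⊛-suc : ∀ p i → (var ⊛ p) (suc i) ≈ θ * p (suc i) + p i
  var-⊛-suc p i = +-congˡ (trans (⊛-cong tail-var (λ _ → refl) i) (⊛-identityˡ p i))
    where
    tail-var : tail var ≋ 𝟙
    tail-var zero    = refl
    tail-var (suc _) = refl

  ∂ : Series → Series
  ∂ p i = suc i · p (suc i)

  ∂-cong : ∀ {p q} → p ≋ q → ∂ p ≋ ∂ q
  ∂-cong e i = ·-congʳ (suc i) (e (suc i))

  ∂-⊕ : ∀ p q → ∂ (p ⊕ q) ≋ ∂ p ⊕ ∂ q
  ∂-⊕ p q i = ·-distrib-+ (p (suc i)) (q (suc i)) (suc i)

  ∂-constant : ∀ {p} → (∀ i → p (suc i) ≈ 0#) → ∂ p ≋ 𝟘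
  ∂-constant e i = ·-zero (suc i) (e i)

  ∂-Div : ∀ {m p} → Div (suc m) p → Div m (∂ p)
  ∂-Div d {i} i<m = ·-zero (suc i) (d (s≤s i<m))

  ∂-sum : ∀ {n} (h : Fin n → Series) → ∂ (sum h) ≋ sum (λ c → ∂ (h c))
  ∂-sum {zero}  h = ∂-constant {𝟘} λ _ → refl
  ∂-sum {suc n} h = S.trans (∂-⊕ (h zero) (sum λ c → h (suc c))) (S.+-congˡ {∂ (h zero)} (∂-sum λ c → h (suc c)))

  ∂-on : ∀ b p → ∂ (on b p) ≋ on b (∂ p)
  ∂-on true  p = S.refl
  ∂-on false p = ∂-constant {𝟘} λ _ → refl

  ∂-var : ∀ p → ∂ (var ⊛ p) ≋ p ⊕ var ⊛ ∂ p
  ∂-var p i = begin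
    suc i · (var ⊛ p) (suc i)                      ≈⟨ ·-congʳ (suc i) (var-⊛-suc p i) ⟩
    suc i · (θ * p (suc i) + p i)                  ≈⟨ ·-distrib-+ _ _ (suc i) ⟩
    suc i · (θ * p (suc i)) + (p i + i · p i)      ≈⟨ +-congʳ (×-comm-* (suc i) θ (p (suc i))) ⟨
    θ * ∂ p i + (p i + i · p i)                    ≈⟨ x∙yz≈y∙xz _ _ _ ⟩
    p i + (θ * ∂ p i + i · p i)                    ≈⟨ +-congˡ (last i) ⟩
    p i + (var ⊛ ∂ p) i                            ∎
    where
    last : ∀ i → θ * ∂ p i + i · p i ≈ (var ⊛ ∂ p) i
    last zero    = +-identityʳ _
    last (suc i) = sym (var-⊛-suc (∂ p) i)

-- Orders of vanishing: interlacing and stability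

module Orders (R : RealField) (θ : RealField.Carrier R) {n : ℕ} (G : Graph n)
  (f : Subset n → PowerSeries.Series R)
  (fam : Families.Family R G (λ _ → Derivative.var R θ) f)
  (f-empty : ∀ {S} → Empty S → PowerSeries._≋_ R (f S) (PowerSeries.𝟙 R)) where
  open PowerSeries R
  open SeriesSums R
  open Families R G
  open Derivative R θ
  open Algebra.Properties.Group S.+-group using (∙-cancelʳ)
  open Algebra.Properties.Ring S.ring using (-‿+-comm; -‿involutive)
  open Relation.Binary.Reasoning.Setoid S.setoid

  -- Differentiating `var ⊛ f (S - u)` for some `u` in `S` produces an extra `f (S - u)`, the
  -- summand of `u` itself. The other summands come from the recurrence at `u` in each `S - v`,
  -- after induction on `S - u` and on the sets `S - u - c`.
  ∂-family : ∀ k S → ∣ S ∣ < k → ∂ (f S) ≋ sum (λ v → on (lookup S v) (f (S - v)))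
  ∂-family (suc k) S s with Subₚ.nonempty? S
  ... | no empty = S.trans (∂-constant {f S} λ i → f-empty empty (suc i)) (S.sym (sum-zero λ v → absent v))
    where
    absent : ∀ v → on (lookup S v) (f (S - v)) ≋ 𝟘
    absent v with lookup S v in e
    ... | true  = ⊥-elim (empty (v , lookup⇒∈ e))
    ... | false = S.refl
  ... | yes (u , u∈S) = ∙-cancelʳ B _ _ (begin
    ∂ (f S) ⊕ B
      ≈⟨ S.+-congˡ B≋B′ ⟩
    ∂ (f S) ⊕ sum (λ c → on (link S u c) (∂ (f (S - u - c))))
      ≈⟨ S.+-congˡ (S.trans (∂-sum (links f S u)) (sum-cong-≋ λ c → ∂-on (link S u c) (f (S - u - c)))) ⟨
    ∂ (f S) ⊕ ∂ (sum (links f S u))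
      ≈⟨ ∂-⊕ (f S) (sum (links f S u)) ⟨
    ∂ (f S ⊕ sum (links f S u))
      ≈⟨ ∂-cong (fam S u u∈S) ⟩
    ∂ (var ⊛ f (S - u))
      ≈⟨ ∂-var (f (S - u)) ⟩
    f (S - u) ⊕ var ⊛ ∂ (f (S - u))
      ≈⟨ S.+-congˡ (S.*-congˡ (∂-family k (S - u) (smaller u∈S s))) ⟩
    f (S - u) ⊕ var ⊛ sum (λ v → on (lookup (S - u) v) (f (S - u - v)))
      ≈⟨ S.+-congˡ A⊕B ⟨
    f (S - u) ⊕ (A ⊕ B)
      ≈⟨ S.+-assoc _ _ _ ⟨
    f (S - u) ⊕ A ⊕ B
      ≈⟨ S.+-congʳ (sum-split u (λ v → on (lookup S v) (f (S - v))) _ at-u λ v v≢u → S.reflexive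
            (≡.cong (λ b → on b (f (S - v))) (≡.sym (lookup-minus S v≢u)))) ⟨
    sum (λ v → on (lookup S v) (f (S - v))) ⊕ B ∎)
    where
    smaller : ∀ {S u k} → u ∈ S → ∣ S ∣ < suc k → ∣ S - u ∣ < k
    smaller u∈S s = ℕₚ.<-≤-trans (Subₚ.x∈p⇒∣p-x∣<∣p∣ u∈S) (ℕ.s≤s⁻¹ s)
    A B : Series
    A = sum (λ v → on (lookup (S - u) v) (f (S - v)))
    B = sum (λ v → on (lookup (S - u) v) (sum (links f (S - v) u)))
    at-u : on (lookup S u) (f (S - u)) ≋ f (S - u) ⊕ on (lookup (S - u) u) (f (S - u))
    at-u rewrite ∈⇒lookup u∈S | lookup-minus-self S u = S.sym (S.+-identityʳ _)
    inner : ∀ c → on (link S u c) (sum λ v → on (lookup (S - u - c) v) (f (S - u - c - v))) ≋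
                  on (link S u c) (∂ (f (S - u - c)))
    inner c with link S u c in e
    ... | false = S.refl
    ... | true  = S.sym (∂-family k (S - u - c)
      (ℕₚ.≤-<-trans (Subₚ.∣p─q∣≤∣p∣ (S - u) _) (smaller u∈S s)))
    B≋B′ : B ≋ sum (λ c → on (link S u c) (∂ (f (S - u - c))))
    B≋B′ = begin
      B
        ≈⟨ sum-cong-≋ (λ v → on-sum (lookup (S - u) v) (links f (S - v) u)) ⟩
      sum (λ v → sum (λ c → on (lookup (S - u) v) (links f (S - v) u c)))
        ≈⟨ sum-cong-≋ (λ v → sum-cong-≋ λ c → links-swap f S u v c) ⟩
      sum (λ v → sum (λ c → on (link S u c) (on (lookup (S - u - c) v) (f (S - u - c - v)))))
        ≈⟨ ∑-comm (λ v c → on (link S u c) (on (lookup (S - u - c) v) (f (S - u - c - v)))) ⟩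
      sum (λ c → sum (λ v → on (link S u c) (on (lookup (S - u - c) v) (f (S - u - c - v)))))
        ≈⟨ sum-cong-≋ (λ c → S.trans (S.sym (on-sum (link S u c) λ v → on (lookup (S - u - c) v) (f (S - u - c - v)))) (inner c)) ⟩
      sum (λ c → on (link S u c) (∂ (f (S - u - c)))) ∎
    row : ∀ v → on (lookup (S - u) v) (f (S - v)) ⊕ on (lookup (S - u) v) (sum (links f (S - v) u))
                ≋ var ⊛ on (lookup (S - u) v) (f (S - u - v))
    row v with lookup (S - u) v in e
    ... | false = S.trans (S.+-identityˡ 𝟘) (S.sym (S.zeroʳ var))
    ... | true  = S.trans (fam (S - v) u (∈-minus⁺ u∈S λ u≡v → proj₂ (∈-minus⁻ {S = S} (lookup⇒∈ e)) (≡.sym u≡v)))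
                          (S.*-congˡ (S.reflexive (≡.cong f (minus-comm S v u))))
    A⊕B : A ⊕ B ≋ var ⊛ sum (λ v → on (lookup (S - u) v) (f (S - u - v)))
    A⊕B = begin
      A ⊕ B
        ≈⟨ ∑-distrib-+ (λ v → on (lookup (S - u) v) (f (S - v))) (λ v → on (lookup (S - u) v) (sum (links f (S - v) u))) ⟨
      sum (λ v → on (lookup (S - u) v) (f (S - v)) ⊕ on (lookup (S - u) v) (sum (links f (S - v) u)))
        ≈⟨ sum-cong-≋ row ⟩
      sum (λ v → var ⊛ on (lookup (S - u) v) (f (S - u - v)))
        ≈⟨ *-distribˡ-sum var (λ v → on (lookup (S - u) v) (f (S - u - v))) ⟨
      var ⊛ sum (λ v → on (lookup (S - u) v) (f (S - u - v))) ∎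

  wronskian : Subset n → Fin n → Series
  wronskian S u = f (S - u) ⊛ ∂ (f S) ⊕ ⊖ (f S ⊛ ∂ (f (S - u)))

  wronskian-term : Subset n → Fin n → Fin n → Series
  wronskian-term S u v =
    f (S - u) ⊛ on (lookup S v) (f (S - v)) ⊕ ⊖ (f S ⊛ on (lookup (S - u) v) (f (S - u - v)))

  -- With the derivative formula in both halves, the summand at a vertex `v ≠ u` of `S` is
  -- `Δ f S u v`; at `u` the second half is switched off and a square remains.
  wronskian-expand : ∀ S u → wronskian S u ≋ sum (wronskian-term S u)
  wronskian-expand S u = S.trans
    (S.+-cong (S.*-congˡ (∂-family (suc ∣ S ∣) S ℕₚ.≤-refl)) (S.-‿cong (S.*-congˡ (∂-family (suc ∣ S - u ∣) (S - u) ℕₚ.≤-refl))))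
    (sum-difference (f (S - u)) (f S) (λ v → on (lookup S v) (f (S - v))) λ v → on (lookup (S - u) v) (f (S - u - v)))

  wronskian-self : ∀ {S u} → u ∈ S → wronskian-term S u u ≋ f (S - u) ⊛ f (S - u)
  wronskian-self {S} {u} u∈S rewrite ∈⇒lookup u∈S | lookup-minus-self S u = square-difference _ _

  germ-wronskian-term : ∀ {S u} → u ∈ S → ∀ v → NonNegGerm (wronskian-term S u v)
  germ-wronskian-term {S} {u} u∈S v with v ≟ u
  ... | yes ≡.refl = germ-resp (S.sym (wronskian-self u∈S)) (germ-square _)
  ... | no v≢u rewrite lookup-minus S v≢u with lookup S v in e
  ...   | false = germ-resp (S.sym (zero-difference _ _)) germ-𝟘
  ...   | true  = germ-Δ fam (suc ∣ S ∣) ℕₚ.≤-refl u∈S (lookup⇒∈ e) (λ u≡v → v≢u (≡.sym u≡v))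

  -- For the successor of `m`: induction makes `f (S - u)` divisible by tᵐ, hence the Wronskian by
  -- the power 2m + 1. Its summand `f (S - u) ⊛ f (S - u)` inherits this, and taking the root gains
  -- the missing factor `t`.
  interlace↓ : ∀ {S u} m → u ∈ S → Div (suc m) (f S) → Div m (f (S - u))
  interlace↓ zero    u∈S d ()
  interlace↓ {S} {u} (suc m) u∈S d = square-root-div m
    (Div-resp (wronskian-self u∈S) (germ-term _ (germ-wronskian-term u∈S)
      (Div-resp (wronskian-expand S u) (Div-⊕ left (Div-⊖ right))) u))
    where
    dᵤ : Div m (f (S - u))
    dᵤ = interlace↓ m u∈S (Div-mono (ℕₚ.n≤1+n (suc m)) d)
    left : Div (suc (m ℕ.+ m)) (f (S - u) ⊛ ∂ (f S))
    left = ≡.subst (λ k → Div k (f (S - u) ⊛ ∂ (f S))) (ℕₚ.+-suc m m) (Div-⊛ dᵤ (∂-Div d))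
    -- Differentiation costs one factor `t`. At `m = 0` the predecessor costs nothing, and
    -- divisibility of `f S` by t² more than suffices.
    derivative : ∀ m → Div m (f (S - u)) → Div (ℕ.pred m) (∂ (f (S - u)))
    derivative zero    _ ()
    derivative (suc m) e = ∂-Div e
    bound : ∀ m → suc (m ℕ.+ m) ℕ.≤ suc (suc m) ℕ.+ ℕ.pred m
    bound zero    = s≤s z≤n
    bound (suc m) = ℕₚ.≤-reflexive (≡.cong (λ k → suc (suc k)) (ℕₚ.+-suc m m))
    right : Div (suc (m ℕ.+ m)) (f S ⊛ ∂ (f (S - u)))
    right = Div-mono (bound m) (Div-⊛ d (derivative m dᵤ))

  -- In the recurrence solved for `f S` every term is divisible by tᵐ, since passing from `S - u` to
  -- `S - u - c` loses at most one factor.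
  interlace↑ : ∀ {S u} m → u ∈ S → Div (suc m) (f (S - u)) → Div m (f S)
  interlace↑ {S} {u} m u∈S d = Div-resp solved (Div-⊕ (Div-⊛ {0} (λ ()) (Div-mono (ℕₚ.n≤1+n m) d)) (Div-⊖ (Div-sum _ branch)))
    where
    branch : ∀ c → Div m (links f S u c)
    branch c with link S u c in e
    ... | false = λ _ → CommutativeRing.refl (OrderedField.commutativeRing R)
    ... | true  = interlace↓ m (proj₁ (link⁻ e)) d
    solved : var ⊛ f (S - u) ⊕ ⊖ sum (links f S u) ≋ f S
    solved = S.trans (S.+-congʳ (S.sym (fam S u u∈S)))
      (S.trans (S.+-assoc _ _ _) (S.trans (S.+-congˡ (S.-‿inverseʳ _)) (S.+-identityʳ _)))

  -- Interlacing bounds the search: if `f (S - u)` has order `j`, then `f S` cannot be divisible by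
  -- the power j + 2.
  order-of : ∀ k S → ∣ S ∣ < k → ∃ (Order (f S))
  order-of (suc k) S s with Subₚ.nonempty? S
  ... | no empty = 0 , (λ ()) , λ e → 0≉1 (trans (sym e) (f-empty empty 0))
    where
    open OrderedField R using (trans; sym)
    open RealField R using (0≉1)
  ... | yes (u , u∈S) with order-of k (S - u) (ℕₚ.<-≤-trans (Subₚ.x∈p⇒∣p-x∣<∣p∣ u∈S) (ℕ.s≤s⁻¹ s))
  ...   | j , o with order-or-divisible (f S) (suc (suc j))
  ...     | inj₁ o′ = o′
  ...     | inj₂ d  = ⊥-elim (ℕₚ.<-irrefl ≡.refl (order-max o (interlace↓ (suc j) u∈S d)))

  ord : Subset n → ℕ
  ord S = proj₁ (order-of (suc ∣ S ∣) S ℕₚ.≤-refl)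

  ord-order : ∀ S → Order (f S) (ord S)
  ord-order S = proj₂ (order-of (suc ∣ S ∣) S ℕₚ.≤-refl)

  order-at : ∀ {S k} → ord S ≡ k → Order (f S) k
  order-at {S} ≡.refl = ord-order S

  div-at : ∀ {S k} → k ℕ.≤ ord S → Div k (f S)
  div-at {S} k≤ = Div-mono k≤ (proj₁ (ord-order S))

  ord↓ : ∀ {S u} → u ∈ S → ord S ℕ.≤ suc (ord (S - u))
  ord↓ {S} {u} u∈S with ord S in e
  ... | zero  = z≤n
  ... | suc m = s≤s (order-max (ord-order (S - u)) (interlace↓ m u∈S (div-at (ℕₚ.≤-reflexive (≡.sym e)))))

  ord↑ : ∀ {S u} → u ∈ S → ord (S - u) ℕ.≤ suc (ord S)
  ord↑ {S} {u} u∈S with ord (S - u) in e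
  ... | zero  = z≤n
  ... | suc m = s≤s (order-max (ord-order S) (interlace↑ m u∈S (div-at (ℕₚ.≤-reflexive (≡.sym e)))))

  ord-comm : ∀ S u v → ord (S - u - v) ≡ ord (S - v - u)
  ord-comm S u v = ≡.cong ord (minus-comm S u v)

  Ess : Subset n → Fin n → Set
  Ess S u = ord S ≡ suc (ord (S - u))

  ess? : ∀ S u → Dec (Ess S u)
  ess? S u = ord S ℕ.≟ suc (ord (S - u))

  non-ess : ∀ {S u} → u ∈ S → ¬ Ess S u → ord S ℕ.≤ ord (S - u)
  non-ess u∈S ¬e = ℕ.s≤s⁻¹ (ℕₚ.≤∧≢⇒< (ord↓ u∈S) ¬e)

  odd-Δ : ∀ {X F S u v} → Family X F → ∀ j → u ∈ S → v ∈ S → u ≢ v → ¬ Order (Δ F S u v) (suc (j ℕ.+ j))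
  odd-Δ famF j u∈S v∈S u≢v (d , ≉0) = ≉0 (Δ-even famF j u∈S v∈S u≢v d ℕₚ.≤-refl)

  -- With `k = ord (S - w)`, `ord S` is k + 1 and `ord (S - u)` is at least that. If it is larger,
  -- interlacing decides. If it is equal and `w` were inessential in `S - u`, the two products in
  -- `Δ f S u w` would have order 2k + 1 and at least 2k + 2, so `Δ` would have odd order.
  ess-persists : ∀ {S u w} → u ∈ S → w ∈ S → ¬ Ess S u → Ess S w → Ess (S - u) w
  ess-persists {S} {u} {w} u∈S w∈S ¬eu ew = ℕₚ.≤-antisym (ord↓ w∈S-u) upper
    where
    k = ord (S - w)
    u≢w : u ≢ w
    u≢w ≡.refl = ¬eu ew
    w∈S-u : w ∈ S - u
    w∈S-u = ∈-minus⁺ w∈S λ w≡u → u≢w (≡.sym w≡u)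
    upper : suc (ord (S - u - w)) ℕ.≤ ord (S - u)
    upper with ord (S - u) ℕ.≟ suc k
    ... | no ≢k = ℕₚ.≤-trans
      (s≤s (ℕₚ.≤-trans (ℕₚ.≤-reflexive (ord-comm S u w)) (ord↑ (∈-minus⁺ u∈S u≢w))))
      (ℕₚ.≤∧≢⇒< (ℕₚ.≤-trans (ℕₚ.≤-reflexive (≡.sym ew)) (non-ess u∈S ¬eu)) λ e → ≢k (≡.sym e))
    ... | yes e with suc (ord (S - u - w)) ℕ.≤? ord (S - u)
    ...   | yes p = p
    ...   | no ¬p = ⊥-elim (odd-Δ fam k u∈S w∈S u≢w (order-⊕ (order-⊛ (order-at e) (ord-order (S - w)))
      (Div-⊖ (Div-mono (ℕₚ.≤-reflexive (≡.cong suc (≡.sym (ℕₚ.+-suc k k))))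
        (Div-⊛ {suc k} {suc k} (div-at (ℕₚ.≤-reflexive (≡.sym ew)))
          (div-at (≡.subst (ℕ._≤ ord (S - u - w)) e (ℕ.s≤s⁻¹ (ℕₚ.≰⇒> ¬p)))))))))

  adj⇒≢ : ∀ {u v} → adj G u v ≡ true → u ≢ v
  adj⇒≢ {u} e ≡.refl with () ← ≡.trans (≡.sym e) (adj-irr G u)

  -- Suppose `a` were neutral and let `k = ord (S - w)`. Both products in `Δ f S a w` then have
  -- order 2k + 1. The edge from `a` to `w` is one of the paths, so the square of `f (S - a - w)`
  -- would be divisible by the power 2k + 1, although `f (S - a - w)` has order only `k`.
  special-positive : ∀ {S a w} → a ∈ S → w ∈ S → adj G a w ≡ true → ¬ Ess S a → Ess S w →
                     ord (S - a) ≡ suc (ord S)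
  special-positive {S} {a} {w} a∈S w∈S adj-aw ¬ea ew with ord (S - a) ℕ.≟ ord S
  ... | no ≢S = ℕₚ.≤-antisym (ord↑ a∈S) (ℕₚ.≤∧≢⇒< (non-ess a∈S ¬ea) λ e → ≢S (≡.sym e))
  ... | yes e = ⊥-elim (ℕₚ.<-irrefl ≡.refl (ℕₚ.≤-trans
      (order-max (ord-order (S - a - w)) (square-root-div k (Δ-edge fam a∈S w∈S a≢w adj-aw
        (Div-⊕ (Div-⊛ (div-at (ℕₚ.≤-reflexive (≡.sym oa))) (div-at ℕₚ.≤-refl))
               (Div-⊖ (Div-⊛ (div-at (ℕₚ.≤-reflexive (≡.sym ew))) (div-at (ℕₚ.≤-reflexive (≡.sym oaw)))))))))
      (ℕₚ.≤-reflexive oaw)))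
    where
    k = ord (S - w)
    a≢w = adj⇒≢ adj-aw
    oa : ord (S - a) ≡ suc k
    oa = ≡.trans e ew
    oaw : ord (S - a - w) ≡ k
    oaw = ℕₚ.suc-injective (≡.trans (≡.sym (ess-persists a∈S w∈S ¬ea ew)) oa)

  looped-in : ∀ {S} w → w ∈ S → f S ⊕ f (S - w) ≋ looped fam w S
  looped-in {S} w w∈S = S.+-congˡ (S.reflexive (≡.cong (λ b → on b (f (S - w))) (≡.sym (∈⇒lookup w∈S))))

  -- If a were essential in S - b, the multiplicities of all subsets of
  -- {a, b, w} would be forced, and giving w a loop would produce a Δ of odd order.
  stability : ∀ {S a w b} → a ∈ S → w ∈ S → adj G a w ≡ true → ¬ Ess S a → Ess S w →
              b ∈ S → b ≢ a → ord (S - a - b) ≡ suc (ord (S - b))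
  stability {S} {a} {w} {b} a∈S w∈S adj-aw ¬ea ew b∈S b≢a with ess? S b
  -- For essential `b` interlacing suffices, because `ord (S - a)` is two more than `ord (S - b)`.
  ... | yes eb = ℕₚ.≤-antisym
      (ℕₚ.≤-trans (ℕₚ.≤-reflexive (ord-comm S a b)) (ord↑ (∈-minus⁺ a∈S λ e → b≢a (≡.sym e))))
      (ℕ.s≤s⁻¹ (≡.subst (ℕ._≤ suc (ord (S - a - b)))
        (≡.trans (special-positive a∈S w∈S adj-aw ¬ea ew) (≡.cong suc eb)) (ord↓ (∈-minus⁺ b∈S b≢a))))
  ... | no ¬eb with ess? (S - b) a
  -- Here `w` is still essential in `S - b`, so `a` is special there.
  ...   | no ¬ea′ = ≡.trans (ord-comm S a b) (special-positive a∈S-b w∈S-b adj-aw ¬ea′ (ess-persists b∈S w∈S ¬eb ew))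
    where
    a∈S-b : a ∈ S - b
    a∈S-b = ∈-minus⁺ a∈S λ e → b≢a (≡.sym e)
    w∈S-b : w ∈ S - b
    w∈S-b = ∈-minus⁺ w∈S λ { ≡.refl → ¬eb ew }
  ...   | yes ea′ = ⊥-elim (odd-Δ (looped-family fam w) j a∈S b∈S a≢b
            (order-resp (S.+-comm _ _) (order-⊕ (order-⊖ FFab) FaFb)))
    where
    j k : ℕ
    j = ord (S - w)
    k = suc j
    a≢b : a ≢ b
    a≢b e = b≢a (≡.sym e)
    b≢w : b ≢ w
    b≢w ≡.refl = ¬eb ew
    a≢w : a ≢ w
    a≢w = adj⇒≢ adj-aw
    w∈S-a : w ∈ S - a
    w∈S-a = ∈-minus⁺ w∈S λ e → a≢w (≡.sym e)
    w∈S-b : w ∈ S - b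
    w∈S-b = ∈-minus⁺ w∈S λ e → b≢w (≡.sym e)
    a∈S-w : a ∈ S - w
    a∈S-w = ∈-minus⁺ a∈S a≢w
    k+k : suc (suc (j ℕ.+ j)) ≡ k ℕ.+ k
    k+k = ≡.cong suc (≡.sym (ℕₚ.+-suc j j))
    oa : ord (S - a) ≡ suc k
    oa = ≡.trans (special-positive a∈S w∈S adj-aw ¬ea ew) (≡.cong suc ew)
    oaw : ord (S - a - w) ≡ k
    oaw = ℕₚ.suc-injective (≡.trans (≡.sym (ess-persists a∈S w∈S ¬ea ew)) oa)
    k≤oab : k ℕ.≤ ord (S - a - b)
    k≤oab = ℕ.s≤s⁻¹ (≡.subst (ℕ._≤ suc (ord (S - a - b))) oa (ord↓ (∈-minus⁺ b∈S b≢a)))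
    ob≤ : ord (S - b) ℕ.≤ suc k
    ob≤ = ≡.subst (λ m → ord (S - b) ℕ.≤ suc m) ew (ord↑ b∈S)
    ob≡ : ord (S - b) ≡ suc (ord (S - a - b))
    ob≡ = ≡.trans ea′ (≡.cong suc (ord-comm S b a))
    oab : ord (S - a - b) ≡ k
    oab = ℕₚ.≤-antisym (ℕ.s≤s⁻¹ (≡.subst (ℕ._≤ suc k) ob≡ ob≤)) k≤oab
    ob : ord (S - b) ≡ suc k
    ob = ≡.trans ob≡ (≡.cong suc oab)
    obw : ord (S - b - w) ≡ k
    obw = ℕₚ.suc-injective (≡.trans (≡.sym (ess-persists b∈S w∈S ¬eb ew)) ob)

    -- The two products have orders j + (k + 1) and k + k, both equal to 2k because k = j + 1.
    Δwb : Div (k ℕ.+ k) (Δ f S w b)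
    Δwb = Div-⊕ (Div-mono (ℕₚ.≤-reflexive (≡.sym (ℕₚ.+-suc j k))) (Div-⊛ (div-at ℕₚ.≤-refl) (div-at (ℕₚ.≤-reflexive (≡.sym ob)))))
                (Div-⊖ (Div-⊛ (div-at (ℕₚ.≤-reflexive (≡.sym ew))) (div-at (ℕₚ.≤-reflexive (≡.sym (≡.trans (ord-comm S w b) obw))))))
    -- The paths from `w` to `b` whose second vertex is `a` make up `Δ` for `a`, `b` in `S - w`, so
    -- it inherits the bound.
    Δab : Div (k ℕ.+ k) (Δ f (S - w) a b)
    Δab = Δ-neighbour fam w∈S b∈S (λ e → b≢w (≡.sym e)) a∈S-w a≢b (≡.trans (adj-sym G w a) adj-aw) Δwb
    fw⊛fwab : Div (k ℕ.+ k) (f (S - w) ⊛ f (S - w - a - b))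
    fw⊛fwab = Div-resp cancel (Div-⊕ (Div-⊛
        (div-at (ℕₚ.≤-reflexive (≡.sym (≡.trans (ord-comm S w a) oaw))))
        (div-at (ℕₚ.≤-reflexive (≡.sym (≡.trans (ord-comm S w b) obw))))) (Div-⊖ Δab))
      where
      cancel : ∀ {p q} → p ⊕ ⊖ (p ⊕ ⊖ q) ≋ q
      cancel {p} {q} = begin
        p ⊕ ⊖ (p ⊕ ⊖ q)      ≈⟨ S.+-congˡ (-‿+-comm p (⊖ q)) ⟨
        p ⊕ (⊖ p ⊕ ⊖ ⊖ q)    ≈⟨ S.+-assoc _ _ _ ⟨
        p ⊕ ⊖ p ⊕ ⊖ ⊖ q      ≈⟨ S.+-cong (S.-‿inverseʳ p) (-‿involutive q) ⟩
        𝟘 ⊕ q                ≈⟨ S.+-identityˡ q ⟩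
        q                    ∎
    -- Only j = k - 1 of the 2k factors come from `f (S - w)`, so at least k + 1 fall to
    -- `f (S - w - a - b)`. This exceeds the order of `f (S - a - b)`, so the loop will not disturb
    -- that order.
    k<oabw : suc k ℕ.≤ ord (S - a - b - w)
    k<oabw = ≡.subst (suc k ℕ.≤_)
      (≡.cong ord (≡.trans (≡.cong (_- b) (minus-comm S w a)) (minus-comm (S - a) w b)))
      (ℕₚ.+-cancelˡ-≤ j _ _ (≡.subst (ℕ._≤ j ℕ.+ ord (S - w - a - b)) (≡.sym (ℕₚ.+-suc j k))
        (order-max (order-⊛ (ord-order (S - w)) (ord-order (S - w - a - b))) fw⊛fwab)))

    F : Subset n → Series
    F = looped fam w
    Fa : Div k (F (S - a))
    Fa = Div-resp (looped-in w w∈S-a) (Div-⊕ (div-at (ℕₚ.<⇒≤ (ℕₚ.≤-reflexive (≡.sym oa)))) (div-at (ℕₚ.≤-reflexive (≡.sym oaw))))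
    Fb : Div k (F (S - b))
    Fb = Div-resp (looped-in w w∈S-b) (Div-⊕ (div-at (ℕₚ.<⇒≤ (ℕₚ.≤-reflexive (≡.sym ob)))) (div-at (ℕₚ.≤-reflexive (≡.sym obw))))
    -- In `F S` the added `f (S - w)` has the smaller order and dominates; this breaks the parity.
    FS : Order (F S) j
    FS = order-resp (S.trans (S.+-comm _ _) (looped-in w w∈S)) (order-⊕ (ord-order (S - w)) (div-at (ℕₚ.≤-reflexive (≡.sym ew))))
    Fab : Order (F (S - a - b)) k
    Fab = order-resp (looped-in w (∈-minus⁺ w∈S-a λ e → b≢w (≡.sym e))) (order-⊕ (order-at oab) (div-at k<oabw))
    FaFb : Div (suc (suc (j ℕ.+ j))) (F (S - a) ⊛ F (S - b))
    FaFb = Div-mono (ℕₚ.≤-reflexive k+k) (Div-⊛ Fa Fb)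
    FFab : Order (F S ⊛ F (S - a - b)) (suc (j ℕ.+ j))
    FFab = ≡.subst (Order _) (ℕₚ.+-suc j j) (order-⊛ FS Fab)

-- Special vertices and extreme sets

module SpecialVertices (R : RealField) (θ : RealField.Carrier R) {n : ℕ} (G : Graph n)
  (f : Subset n → PowerSeries.Series R)
  (fam : Families.Family R G (λ _ → Derivative.var R θ) f)
  (f-empty : ∀ {S} → Empty S → PowerSeries._≋_ R (f S) (PowerSeries.𝟙 R)) where
  open Orders R θ G f fam f-empty
  open ≡.≡-Reasoning

  record SpecialIn (S : Subset n) (a : Fin n) : Set where
    constructor special
    field
      {neighbour} : Fin n
      member      : a ∈ S
      inessential : ¬ Ess S a
      neighbour∈  : neighbour ∈ S
      adjacent    : adj G a neighbour ≡ true
      essential   : Ess S neighbour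

  special-ord : ∀ {S a} → SpecialIn S a → ord (S - a) ≡ suc (ord S)
  special-ord (special a∈ ¬ea w∈ e ew) = special-positive a∈ w∈ e ¬ea ew

  special-stable : ∀ {S a b} → SpecialIn S a → b ∈ S → b ≢ a → ord (S - a - b) ≡ suc (ord (S - b))
  special-stable (special a∈ ¬ea w∈ e ew) = stability a∈ w∈ e ¬ea ew

  -- Stability keeps `a` inessential, since deleting it from `S - u` raises the order. The essential
  -- neighbour differs from the inessential `u` and stays essential.
  special-minus : ∀ {S a u} → SpecialIn S a → u ∈ S → u ≢ a → ¬ Ess S u → SpecialIn (S - u) a
  special-minus {S} {a} {u} sp@(special {w} a∈ ¬ea w∈ e ew) u∈ u≢a ¬eu = special
    (∈-minus⁺ a∈ λ a≡u → u≢a (≡.sym a≡u))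
    (λ ea → ℕₚ.<⇒≢ (s≤s (ℕₚ.n≤1+n _)) (≡.trans ea (≡.cong suc (≡.trans (ord-comm S u a) (special-stable sp u∈ u≢a)))))
    (∈-minus⁺ w∈ λ { ≡.refl → ¬eu ew })
    e (ess-persists u∈ w∈ ¬eu ew)

  -- The vertex `v` is kept in the ambient set and deleted last, so that the rest of `A` remains
  -- special after each deletion; stability transfers the gain of one from `S` to `S - v`.
  special-extreme : ∀ k {A S v} → ∣ A ∣ ≡ k → (∀ {a} → a ∈ A → SpecialIn S a) → v ∈ S → v ∉ A →
                    ord ((S ─ A) - v) ≡ ∣ A ∣ ℕ.+ ord (S - v)
  special-extreme k {A} {S} {v} c sp v∈S v∉A with Subₚ.nonempty? A
  ... | no empty with ≡.refl ← Subₚ.Empty-unique empty =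
    ≡.trans (≡.cong (λ T → ord (T - v)) (Subₚ.p─⊥≡p S)) (≡.cong (ℕ._+ ord (S - v)) (≡.sym (Subₚ.∣⊥∣≡0 n)))
  special-extreme zero {A} c sp v∈S v∉A | yes (a , a∈A) with () ← ≡.trans (≡.sym c) (∣minus∣ a∈A)
  special-extreme (suc k) {A} {S} {v} c sp v∈S v∉A | yes (a , a∈A) = begin
    ord ((S ─ A) - v)                      ≡⟨ ≡.cong (λ T → ord (T - v)) (minus-─-minus S a∈A) ⟨
    ord (((S - a) ─ (A - a)) - v)          ≡⟨ special-extreme k (ℕₚ.suc-injective (≡.trans (≡.sym (∣minus∣ a∈A)) c)) sp′
                                                (∈-minus⁺ v∈S v≢a) (λ v∈ → v∉A (proj₁ (∈-minus⁻ v∈))) ⟩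
    ∣ A - a ∣ ℕ.+ ord (S - a - v)          ≡⟨ ≡.cong (∣ A - a ∣ ℕ.+_) (special-stable (sp a∈A) v∈S v≢a) ⟩
    ∣ A - a ∣ ℕ.+ suc (ord (S - v))        ≡⟨ ℕₚ.+-suc ∣ A - a ∣ (ord (S - v)) ⟩
    suc (∣ A - a ∣) ℕ.+ ord (S - v)        ≡⟨ ≡.cong (ℕ._+ ord (S - v)) (∣minus∣ a∈A) ⟨
    ∣ A ∣ ℕ.+ ord (S - v)                  ∎
    where
    v≢a : v ≢ a
    v≢a ≡.refl = v∉A a∈A
    sp′ : ∀ {b} → b ∈ A - a → SpecialIn (S - a) b
    sp′ b∈ with ∈-minus⁻ b∈
    ... | b∈A , b≢a = special-minus (sp b∈A) (SpecialIn.member (sp a∈A)) (λ a≡b → b≢a (≡.sym a≡b)) (SpecialIn.inessential (sp a∈A))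

-- Counting edge sets by sums of indicators

module ℕSum = Algebra.Properties.CommutativeMonoid.Sum ℕₚ.+-0-commutativeMonoid

ind : Bool → ℕ
ind true  = 1
ind false = 0

total : {A : Set} → List A → (A → ℕ) → ℕ
total []       g = 0
total (x ∷ xs) g = g x ℕ.+ total xs g

module _ {A : Set} where

  total-cong : ∀ (xs : List A) {g h : A → ℕ} → (∀ x → g x ≡ h x) → total xs g ≡ total xs h
  total-cong []       e = ≡.refl
  total-cong (x ∷ xs) e = ≡.cong₂ ℕ._+_ (e x) (total-cong xs e)

  total-zero : ∀ (xs : List A) → total xs (λ _ → 0) ≡ 0
  total-zero []       = ≡.refl
  total-zero (x ∷ xs) = total-zero xs

  total-+ : ∀ (xs : List A) g h → total xs (λ x → g x ℕ.+ h x) ≡ total xs g ℕ.+ total xs h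
  total-+ []       g h = ≡.refl
  total-+ (x ∷ xs) g h = ≡.trans (≡.cong (g x ℕ.+ h x ℕ.+_) (total-+ xs g h)) (interchange (g x) (h x) _ _)
    where open import Algebra.Properties.CommutativeSemigroup ℕₚ.+-commutativeSemigroup using (interchange)

  total-sum : ∀ {n} (xs : List A) (g : A → Fin n → ℕ) →
              total xs (λ x → ℕSum.sum (g x)) ≡ ℕSum.sum (λ c → total xs (λ x → g x c))
  total-sum {zero}  xs g = total-zero xs
  total-sum {suc n} xs g = ≡.trans (total-+ xs (λ x → g x zero) (λ x → ℕSum.sum (g x ∘ suc)))
    (≡.cong (total xs (λ x → g x zero) ℕ.+_) (total-sum xs (λ x c → g x (suc c))))

  total-++ : ∀ (xs ys : List A) g → total (xs ++ ys) g ≡ total xs g ℕ.+ total ys g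
  total-++ []       ys g = ≡.refl
  total-++ (x ∷ xs) ys g = ≡.trans (≡.cong (g x ℕ.+_) (total-++ xs ys g)) (≡.sym (ℕₚ.+-assoc (g x) _ _))

  total-map : ∀ {B : Set} (h : B → A) xs g → total (List.map h xs) g ≡ total xs (g ∘ h)
  total-map h []       g = ≡.refl
  total-map h (x ∷ xs) g = ≡.cong (g (h x) ℕ.+_) (total-map h xs g)

  total-tabulate : ∀ {n} (h : Fin n → A) g → total (tabulate h) g ≡ ℕSum.sum (g ∘ h)
  total-tabulate {zero}  h g = ≡.refl
  total-tabulate {suc n} h g = ≡.cong (g (h zero) ℕ.+_) (total-tabulate (h ∘ suc) g)

  count≡total : ∀ (P : A → Bool) xs → length (filter (λ x → P x Bool.≟ true) xs) ≡ total xs (ind ∘ P)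
  count≡total P [] = ≡.refl
  count≡total P (x ∷ xs) with P x
  ... | true  = ≡.cong suc (count≡total P xs)
  ... | false = count≡total P xs

total-concatMap : ∀ {A B : Set} (h : A → List B) xs g → total (concatMap h xs) g ≡ total xs (λ x → total (h x) g)
total-concatMap h []       g = ≡.refl
total-concatMap h (x ∷ xs) g =
  ≡.trans (total-++ (h x) (concatMap h xs) g) (≡.cong (total (h x) g ℕ.+_) (total-concatMap h xs g))

total-allVecs : ∀ {A : Set} (xs : List A) k g →
  total (allVecs xs (suc k)) g ≡ total xs (λ x → total (allVecs xs k) (λ v → g (x ∷ v)))
total-allVecs xs k g = ≡.trans (total-concatMap (λ x → List.map (x ∷_) (allVecs xs k)) xs g)
  (total-cong xs λ x → total-map (x ∷_) (allVecs xs k) g)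

-- Expresses that `h` permutes the list, in the form needed to reindex a count; no inverse of `h`
-- has to be exhibited.
Invariant : {A : Set} → List A → (A → A) → Set
Invariant xs h = ∀ g → total xs (g ∘ h) ≡ total xs g

invariant-allVecs : ∀ {A : Set} {xs : List A} {h} → Invariant xs h →
                    ∀ k (i : Fin k) → Invariant (allVecs xs k) (λ v → updateAt v i h)
invariant-allVecs {xs = xs} {h} inv (suc k) zero g =
  ≡.trans (total-allVecs xs k _) (≡.trans (inv λ x → total (allVecs xs k) (λ v → g (x ∷ v))) (≡.sym (total-allVecs xs k g)))
invariant-allVecs {xs = xs} {h} inv (suc k) (suc i) g =
  ≡.trans (total-allVecs xs k _) (≡.trans (total-cong xs λ x → invariant-allVecs inv k i (λ v → g (x ∷ v)))
    (≡.sym (total-allVecs xs k g)))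

-- One map for both adding and removing an edge, defined on every edge set, so that invariance needs
-- no condition on `M`.
toggle : ∀ {n} → Fin n → Fin n → EdgeSet n → EdgeSet n
toggle i j M = updateAt M i (λ row → updateAt row j not)

invariant-toggle : ∀ {n} (i j : Fin n) → Invariant (allEdgeSets n) (toggle i j)
invariant-toggle {n} i j = invariant-allVecs (invariant-allVecs invariant-not n j) n i
  where
  invariant-not : Invariant (true ∷ false ∷ []) not
  invariant-not g = ≡.trans (≡.cong (g false ℕ.+_) (ℕₚ.+-identityʳ (g true)))
    (≡.trans (ℕₚ.+-comm (g false) (g true)) (≡.cong (g true ℕ.+_) (≡.sym (ℕₚ.+-identityʳ (g false)))))

-- Applied to the entries of a row and then to the rows of an edge set, it shows that the empty edge
-- set is listed exactly once.
weightless-once : ∀ {A : Set} {xs : List A} (w : A → ℕ) → total xs (λ x → ind (w x ≡ᵇ 0)) ≡ 1 →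
  ∀ k → total (allVecs xs k) (λ v → ind (ℕSum.sum (w ∘ lookup v) ≡ᵇ 0)) ≡ 1
weightless-once w e zero = ≡.refl
weightless-once {A} {xs} w e (suc k) =
  ≡.trans (total-allVecs xs k _) (≡.trans (total-cong xs inner) e)
  where
  inner : ∀ x → total (allVecs xs k) (λ v → ind (w x ℕ.+ ℕSum.sum (w ∘ lookup v) ≡ᵇ 0)) ≡ ind (w x ≡ᵇ 0)
  inner x with w x
  ... | zero  = weightless-once w e k
  ... | suc _ = total-zero (allVecs xs k)

∣∣≡sum : ∀ {n} (S : Subset n) → ∣ S ∣ ≡ ℕSum.sum (ind ∘ lookup S)
∣∣≡sum []          = ≡.refl
∣∣≡sum (true  ∷ S) = ≡.cong suc (∣∣≡sum S)
∣∣≡sum (false ∷ S) = ∣∣≡sum S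

size≡sum : ∀ {n} (M : EdgeSet n) → size M ≡ ℕSum.sum (λ i → ∣ lookup M i ∣)
size≡sum {n} M = ≡.trans (listSum (List.map (λ i → ∣ lookup M i ∣) (allFin n)))
  (≡.trans (total-map (λ i → ∣ lookup M i ∣) (allFin n) id) (total-tabulate id λ i → ∣ lookup M i ∣))
  where
  listSum : ∀ xs → ListActionℕ.sum xs ≡ total xs id
  listSum []       = ≡.refl
  listSum (x ∷ xs) = ≡.cong (x ℕ.+_) (listSum xs)

edgeless-once : ∀ n → total (allEdgeSets n) (λ M → ind (size M ≡ᵇ 0)) ≡ 1
edgeless-once n = ≡.trans (total-cong (allEdgeSets n) λ M → ≡.cong (λ k → ind (k ≡ᵇ 0)) (size≡sum M))
  (weightless-once ∣_∣ rows n)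
  where
  rows : total (allVecs (true ∷ false ∷ []) n) (λ v → ind (∣ v ∣ ≡ᵇ 0)) ≡ 1
  rows = ≡.trans (total-cong (allVecs (true ∷ false ∷ []) n) λ v → ≡.cong (λ k → ind (k ≡ᵇ 0)) (∣∣≡sum v))
    (weightless-once ind ≡.refl n)

sum-suc : ∀ {n} (u : Fin n) {h h′ : Fin n → ℕ} → h u ≡ suc (h′ u) → (∀ c → c ≢ u → h c ≡ h′ c) →
          ℕSum.sum h ≡ suc (ℕSum.sum h′)
sum-suc zero    e es = ≡.cong₂ ℕ._+_ e (ℕSum.sum-cong-≗ λ c → es (suc c) λ ())
sum-suc (suc u) {h} {h′} e es = ≡.trans
  (≡.cong₂ ℕ._+_ (es zero λ ()) (sum-suc u e λ c c≢u → es (suc c) λ e → c≢u (Finₚ.suc-injective e)))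
  (ℕₚ.+-suc (h′ zero) _)

sum-zeros : ∀ {n} {h : Fin n → ℕ} → (∀ c → h c ≡ 0) → ℕSum.sum h ≡ 0
sum-zeros {n} e = ≡.trans (ℕSum.sum-cong-≗ e) (ℕSum.sum-replicate-zero n)

sum-zero⁻ : ∀ {n} {h : Fin n → ℕ} → ℕSum.sum h ≡ 0 → ∀ c → h c ≡ 0
sum-zero⁻ {h = h} e zero    = ℕₚ.m+n≡0⇒m≡0 (h zero) e
sum-zero⁻ {h = h} e (suc c) = sum-zero⁻ (ℕₚ.m+n≡0⇒n≡0 (h zero) e) c

toggle-at : ∀ {n} (i j : Fin n) M → chosen (toggle i j M) i j ≡ not (chosen M i j)
toggle-at i j M = ≡.trans (≡.cong (λ row → lookup row j) (Vecₚ.lookup∘updateAt i M))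
                          (Vecₚ.lookup∘updateAt j (lookup M i))

toggle-off : ∀ {n} (i j : Fin n) M {a b} → ¬ (a ≡ i × b ≡ j) → chosen (toggle i j M) a b ≡ chosen M a b
toggle-off i j M {a} {b} ≢ij with a ≟ i
... | no a≢i = ≡.cong (λ row → lookup row b) (Vecₚ.lookup∘updateAt′ a i a≢i M)
... | yes ≡.refl = ≡.trans (≡.cong (λ row → lookup row b) (Vecₚ.lookup∘updateAt i M))
                           (Vecₚ.lookup∘updateAt′ b j (λ b≡j → ≢ij (≡.refl , b≡j)) (lookup M i))

size-toggle : ∀ {n} (i j : Fin n) M → chosen M i j ≡ true → size M ≡ suc (size (toggle i j M))
size-toggle i j M e = ≡.trans (size≡sum M) (≡.trans
  (sum-suc i row-i λ c c≢i → ≡.cong ∣_∣ (≡.sym (Vecₚ.lookup∘updateAt′ c i c≢i M)))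
  (≡.cong suc (≡.sym (size≡sum (toggle i j M)))))
  where
  ∣toggled∣ : ∀ {n} (S : Subset n) j → lookup S j ≡ true → ∣ S ∣ ≡ suc ∣ updateAt S j not ∣
  ∣toggled∣ (true  ∷ S) zero    e = ≡.refl
  ∣toggled∣ (true  ∷ S) (suc j) e = ≡.cong suc (∣toggled∣ S j e)
  ∣toggled∣ (false ∷ S) (suc j) e = ∣toggled∣ S j e
  row-i : ∣ lookup M i ∣ ≡ suc ∣ lookup (toggle i j M) i ∣
  row-i = ≡.trans (∣toggled∣ (lookup M i) j e) (≡.cong (suc ∘ ∣_∣) (≡.sym (Vecₚ.lookup∘updateAt i M)))

AtMostOne : ∀ {n} → (Fin n → Bool) → Set
AtMostOne b = ∀ {w w′} → b w ≡ true → b w′ ≡ true → w ≡ w′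

sum-ind-one : ∀ {n} {b : Fin n → Bool} {c} → AtMostOne b → b c ≡ true → ℕSum.sum (ind ∘ b) ≡ 1
sum-ind-one {n} {b} {c} amo bc = ≡.trans (sum-suc c {h′ = λ _ → 0} (≡.cong ind bc) others) (≡.cong suc (sum-zeros {n} λ _ → ≡.refl))
  where
  others : ∀ d → d ≢ c → ind (b d) ≡ 0
  others d d≢c with b d in bd
  ... | true  = ⊥-elim (d≢c (amo bd bc))
  ... | false = ≡.refl

countᶠ≡sum : ∀ {n} (b : Fin n → Bool) → countᶠ b ≡ ℕSum.sum (ind ∘ b)
countᶠ≡sum {n} b = ≡.trans (count≡total b (allFin n)) (total-tabulate id (ind ∘ b))

atMostOne⁺ : ∀ {n} (b : Fin n → Bool) → (countᶠ b ≤ᵇ 1) ≡ true → AtMostOne b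
atMostOne⁺ b e {w} {w′} = unique b (≡.subst (ℕ._≤ 1) (countᶠ≡sum b) (ℕₚ.≤ᵇ⇒≤ (countᶠ b) 1 (≡.subst T (≡.sym e) _)))
  where
  unique : ∀ {n} (b : Fin n → Bool) → ℕSum.sum (ind ∘ b) ℕ.≤ 1 → AtMostOne b
  unique b s {zero}  {zero}   p q = ≡.refl
  unique b s {suc w} {suc w′} p q = ≡.cong suc (unique (b ∘ suc) (ℕₚ.m+n≤o⇒n≤o (ind (b zero)) s) p q)
  unique b s {zero}  {suc w′} p q
    with () ← ≡.trans (≡.cong ind (≡.sym q)) (sum-zero⁻ {h = ind ∘ b ∘ suc} (ℕₚ.n≤0⇒n≡0 (ℕ.s≤s⁻¹
                (≡.subst (λ x → ind x ℕ.+ ℕSum.sum (ind ∘ b ∘ suc) ℕ.≤ 1) p s))) w′)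
  unique b s {suc w} {zero}   p q = ≡.sym (unique b s {zero} {suc w} q p)

atMostOne⁻ : ∀ {n} (b : Fin n → Bool) → AtMostOne b → (countᶠ b ≤ᵇ 1) ≡ true
atMostOne⁻ b amo rewrite countᶠ≡sum b with Finₚ.any? (λ c → b c Bool.≟ true)
... | yes (c , bc) rewrite sum-ind-one amo bc = ≡.refl
... | no none rewrite sum-zeros {h = ind ∘ b} (λ c → ≡.cong ind (Boolₚ.¬-not (λ e → none (c , e)))) = ≡.refl

∧⁻ : ∀ {a b} → a ∧ b ≡ true → a ≡ true × b ≡ true
∧⁻ {true} {true} _ = ≡.refl , ≡.refl

∧⁺ : ∀ {a b} → a ≡ true → b ≡ true → a ∧ b ≡ true
∧⁺ ≡.refl ≡.refl = ≡.refl

bool-ext : ∀ {a b} → (a ≡ true → b ≡ true) → (b ≡ true → a ≡ true) → a ≡ b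
bool-ext {true}  {b}     f g = ≡.sym (f ≡.refl)
bool-ext {false} {false} f g = ≡.refl
bool-ext {false} {true}  f g = g ≡.refl

all⁺ : ∀ {n} (b : Fin n → Bool) → allᶠ b ≡ true → ∀ i → b i ≡ true
all⁺ b = go b id
  where
  go : ∀ {A : Set} {k} (b : A → Bool) (h : Fin k → A) → ListActionBool.all b (tabulate h) ≡ true → ∀ i → b (h i) ≡ true
  go b h e zero    = proj₁ (∧⁻ e)
  go b h e (suc i) = go b (h ∘ suc) (proj₂ (∧⁻ {b (h zero)} e)) i

all⁻ : ∀ {n} (b : Fin n → Bool) → (∀ i → b i ≡ true) → allᶠ b ≡ true
all⁻ b e = go id λ i → e i
  where
  go : ∀ {k} (h : Fin k → _) → (∀ i → b (h i) ≡ true) → ListActionBool.all b (tabulate h) ≡ true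
  go {zero}  h e = ≡.refl
  go {suc k} h e = ∧⁺ (e zero) (go (h ∘ suc) (e ∘ suc))

-- Recurrence for the numbers of matchings

module Matchings {n : ℕ} (G : Graph n) where

  incident : EdgeSet n → Fin n → Fin n → Bool
  incident M v w = chosen M v w ∨ chosen M w v

  record Matching (S : Subset n) (M : EdgeSet n) : Set where
    field
      ordered : ∀ {i j} → chosen M i j ≡ true → toℕ i < toℕ j
      edge    : ∀ {i j} → chosen M i j ≡ true → adj G i j ≡ true
      startIn : ∀ {i j} → chosen M i j ≡ true → i ∈ S
      endIn   : ∀ {i j} → chosen M i j ≡ true → j ∈ S
      unique  : ∀ v → AtMostOne (incident M v)
  open Matching

  matching⁺ : ∀ S M → isMatching G S M ≡ true → Matching S M
  matching⁺ S M e = record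
    { ordered = λ {i} {j} p → ℕₚ.<ᵇ⇒< (toℕ i) (toℕ j) (≡.subst T (≡.sym (proj₁ (parts p))) _)
    ; edge    = λ p → proj₁ (proj₂ (parts p))
    ; startIn = λ p → lookup⇒∈ (proj₁ (proj₂ (proj₂ (parts p))))
    ; endIn   = λ p → lookup⇒∈ (proj₂ (proj₂ (proj₂ (parts p))))
    ; unique  = λ v → atMostOne⁺ (incident M v) (all⁺ _ (proj₂ (∧⁻ e)) v)
    }
    where
    parts : ∀ {i j} → chosen M i j ≡ true →
            (toℕ i <ᵇ toℕ j) ≡ true × adj G i j ≡ true × lookup S i ≡ true × lookup S j ≡ true
    parts {i} {j} p with all⁺ _ (all⁺ _ (proj₁ (∧⁻ e)) i) j
    ... | q rewrite p with ∧⁻ {toℕ i <ᵇ toℕ j} q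
    ...   | q₁ , q′ with ∧⁻ {adj G i j} q′
    ...     | q₂ , q″ = q₁ , q₂ , ∧⁻ q″

  matching⁻ : ∀ {S M} → Matching S M → isMatching G S M ≡ true
  matching⁻ {S} {M} m = ∧⁺ (all⁻ _ λ i → all⁻ _ λ j → entry i j) (all⁻ _ λ v → atMostOne⁻ (incident M v) (unique m v))
    where
    entry : ∀ i j → imp (chosen M i j) ((toℕ i <ᵇ toℕ j) ∧ adj G i j ∧ lookup S i ∧ lookup S j) ≡ true
    entry i j with chosen M i j in p
    ... | false = ≡.refl
    ... | true  = ∧⁺ (<⇒<ᵇ≡true (ordered m p)) (∧⁺ (edge m p) (∧⁺ (∈⇒lookup (startIn m p)) (∈⇒lookup (endIn m p))))
      where
      <⇒<ᵇ≡true : ∀ {a b} → a < b → (a <ᵇ b) ≡ true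
      <⇒<ᵇ≡true {a} {b} a<b with a <ᵇ b | ℕₚ.<⇒<ᵇ a<b
      ... | true | _ = ≡.refl

  matching-⊆ : ∀ {S S′ M} → S ⊆ S′ → Matching S M → Matching S′ M
  matching-⊆ S⊆S′ m = record
    { ordered = ordered m ; edge = edge m ; unique = unique m
    ; startIn = λ p → S⊆S′ (startIn m p) ; endIn = λ p → S⊆S′ (endIn m p) }

  incident⁻ : ∀ M v w → incident M v w ≡ true → chosen M v w ≡ true ⊎ chosen M w v ≡ true
  incident⁻ M v w e with chosen M v w
  ... | true  = inj₁ ≡.refl
  ... | false = inj₂ e

  incidentˡ : ∀ M v w → chosen M v w ≡ true → incident M v w ≡ true
  incidentˡ M v w p rewrite p = ≡.refl

  incidentʳ : ∀ M v w → chosen M w v ≡ true → incident M v w ≡ true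
  incidentʳ M v w p rewrite p = Boolₚ.∨-zeroʳ (chosen M v w)

  incident-in : ∀ {S M v w} → Matching S M → incident M v w ≡ true → v ∈ S × w ∈ S × v ≢ w × adj G v w ≡ true
  incident-in {S} {M} {v} {w} m e with incident⁻ M v w e
  ... | inj₁ p = startIn m p , endIn m p , (λ v≡w → ℕₚ.<⇒≢ (ordered m p) (≡.cong toℕ v≡w)) , edge m p
  ... | inj₂ p = endIn m p , startIn m p , (λ v≡w → ℕₚ.<⇒≢ (ordered m p) (≡.cong toℕ (≡.sym v≡w))) , ≡.trans (adj-sym G v w) (edge m p)

  matching-minus : ∀ {S M u} → Matching S M → (∀ c → ¬ incident M u c ≡ true) → Matching (S - u) M
  matching-minus {S} {M} {u} m none = record
    { ordered = ordered m ; edge = edge m ; unique = unique m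
    ; startIn = λ {i} {j} p → ∈-minus⁺ (startIn m p) λ { ≡.refl → none j (incidentˡ M u j p) }
    ; endIn   = λ {i} {j} p → ∈-minus⁺ (endIn m p) λ { ≡.refl → none i (incidentʳ M j i p) } }

  -- Uniqueness at `i` and at `j` forbids any other chosen edge there; the reversed pair is excluded
  -- by the order of the ends.
  remove-edge : ∀ {S M i j} → Matching S M → chosen M i j ≡ true → Matching (S - i - j) (toggle i j M)
  remove-edge {S} {M} {i} {j} m ij = record
    { ordered = λ p → ordered m (keep p)
    ; edge    = λ p → edge m (keep p)
    ; startIn = λ {a} {b} p → ∈-minus⁺ (∈-minus⁺ (startIn m (keep p))
        (λ { ≡.refl → removed p (≡.refl , unique m i (incidentˡ M i b (keep p)) (incidentˡ M i j ij)) }))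
        (λ { ≡.refl → backwards (keep p) (unique m j (incidentˡ M j b (keep p)) (incidentʳ M j i ij)) })
    ; endIn   = λ {a} {b} p → ∈-minus⁺ (∈-minus⁺ (endIn m (keep p))
        (λ { ≡.refl → backwards′ (keep p) (unique m i (incidentʳ M i a (keep p)) (incidentˡ M i j ij)) }))
        (λ { ≡.refl → removed p (unique m j (incidentʳ M j a (keep p)) (incidentʳ M j i ij) , ≡.refl) })
    ; unique  = λ v {w} {w′} p q → unique m v (keep-incident v w p) (keep-incident v w′ q)
    }
    where
    removed : ∀ {a b} → chosen (toggle i j M) a b ≡ true → ¬ (a ≡ i × b ≡ j)
    removed p (≡.refl , ≡.refl) with () ← ≡.trans (≡.sym p) (≡.trans (toggle-at i j M) (≡.cong not ij))
    keep : ∀ {a b} → chosen (toggle i j M) a b ≡ true → chosen M a b ≡ true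
    keep p = ≡.trans (≡.sym (toggle-off i j M (removed p))) p
    keep-incident : ∀ v w → incident (toggle i j M) v w ≡ true → incident M v w ≡ true
    keep-incident v w p with incident⁻ (toggle i j M) v w p
    ... | inj₁ q = incidentˡ M v w (keep q)
    ... | inj₂ q = incidentʳ M v w (keep q)
    backwards : ∀ {b} → chosen M j b ≡ true → ¬ b ≡ i
    backwards p ≡.refl = ℕₚ.<-asym (ordered m ij) (ordered m p)
    backwards′ : ∀ {a} → chosen M a i ≡ true → ¬ a ≡ j
    backwards′ p ≡.refl = ℕₚ.<-asym (ordered m ij) (ordered m p)

  module _ {S : Subset n} {M : EdgeSet n} {i j : Fin n} (m : Matching (S - i - j) (toggle i j M)) where
    private
      M′ = toggle i j M

      i∉ : i ∉ S - i - j
      i∉ i∈ = proj₂ (∈-minus⁻ {S = S} (proj₁ (∈-minus⁻ i∈))) ≡.refl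

      j∉ : j ∉ S - i - j
      j∉ j∈ = proj₂ (∈-minus⁻ {S = S - i} j∈) ≡.refl

    -- Otherwise toggling would have added an edge with the end `i`, which lies outside `S - i - j`.
    was-chosen : chosen M i j ≡ true
    was-chosen with chosen M i j in e
    ... | true  = ≡.refl
    ... | false = ⊥-elim (i∉ (startIn m (≡.trans (toggle-at i j M) (≡.cong not e))))

    private
      origin : ∀ {a b} → chosen M a b ≡ true → (a ≡ i × b ≡ j) ⊎ chosen M′ a b ≡ true
      origin {a} {b} p with a ≟ i | b ≟ j
      ... | yes e | yes e′ = inj₁ (e , e′)
      ... | yes _ | no b≢j = inj₂ (≡.trans (toggle-off i j M λ e → b≢j (proj₂ e)) p)
      ... | no a≢i | _     = inj₂ (≡.trans (toggle-off i j M λ e → a≢i (proj₁ e)) p)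

      data Origin (v w : Fin n) : Set where
        forward  : v ≡ i → w ≡ j → Origin v w
        backward : v ≡ j → w ≡ i → Origin v w
        old      : incident M′ v w ≡ true → Origin v w

      incident-origin : ∀ {v w} → incident M v w ≡ true → Origin v w
      incident-origin {v} {w} p with incident⁻ M v w p
      ... | inj₁ q with origin q
      ...   | inj₁ (e , e′) = forward e e′
      ...   | inj₂ q′       = old (incidentˡ M′ v w q′)
      incident-origin {v} {w} p | inj₂ q with origin q
      ...   | inj₁ (e , e′) = backward e′ e
      ...   | inj₂ q′       = old (incidentʳ M′ v w q′)

      old-end : ∀ {v w} → incident M′ v w ≡ true → v ≢ i × v ≢ j
      old-end p = (λ { ≡.refl → i∉ (proj₁ (incident-in m p)) }) , (λ { ≡.refl → j∉ (proj₁ (incident-in m p)) })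

    add-edge : toℕ i < toℕ j → adj G i j ≡ true → i ∈ S → j ∈ S → Matching S M
    add-edge i<j eij i∈S j∈S = record
      { ordered = λ p → [ (λ { (≡.refl , ≡.refl) → i<j }) , ordered m ] (origin p)
      ; edge    = λ p → [ (λ { (≡.refl , ≡.refl) → eij }) , edge m ] (origin p)
      ; startIn = λ p → [ (λ { (≡.refl , ≡.refl) → i∈S }) , (λ q → back (startIn m q)) ] (origin p)
      ; endIn   = λ p → [ (λ { (≡.refl , ≡.refl) → j∈S }) , (λ q → back (endIn m q)) ] (origin p)
      ; unique  = λ v p q → same (incident-origin p) (incident-origin q)
      }
      where
      back : ∀ {x} → x ∈ S - i - j → x ∈ S
      back x∈ = proj₁ (∈-minus⁻ (proj₁ (∈-minus⁻ x∈)))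
      i≢j : i ≢ j
      i≢j e = ℕₚ.<⇒≢ i<j (≡.cong toℕ e)
      same : ∀ {v w w′} → Origin v w → Origin v w′ → w ≡ w′
      same (forward _ e)  (forward _ e′)  = ≡.trans e (≡.sym e′)
      same (backward _ e) (backward _ e′) = ≡.trans e (≡.sym e′)
      same (forward e _)  (backward e′ _) = ⊥-elim (i≢j (≡.trans (≡.sym e) e′))
      same (backward e _) (forward e′ _)  = ⊥-elim (i≢j (≡.trans (≡.sym e′) e))
      same (old p)        (old q)         = unique m _ p q
      same (old p)        (forward e _)   = ⊥-elim (proj₁ (old-end p) e)
      same (old p)        (backward e _)  = ⊥-elim (proj₂ (old-end p) e)
      same (forward e _)  (old q)         = ⊥-elim (proj₁ (old-end q) e)
      same (backward e _) (old q)         = ⊥-elim (proj₂ (old-end q) e)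

  open Links G

  num : Subset n → ℕ → ℕ
  num = numMatchings G

  hits : Subset n → ℕ → EdgeSet n → Bool
  hits S r M = isMatching G S M ∧ (size M ≡ᵇ r)

  num≡total : ∀ S r → num S r ≡ total (allEdgeSets n) (ind ∘ hits S r)
  num≡total S r = count≡total (hits S r) (allEdgeSets n)

  -- A matching of `S` either misses `u`, and is a matching of `S - u`, or has exactly one partner
  -- `c` of `u`. The flag `z` will carry the size condition.
  vertex-split : ∀ S u z M → ind (isMatching G S M ∧ z) ≡
    ind (isMatching G (S - u) M ∧ z) ℕ.+ ℕSum.sum (λ c → ind ((isMatching G S M ∧ z) ∧ incident M u c))
  vertex-split S u false M
    rewrite Boolₚ.∧-zeroʳ (isMatching G S M) | Boolₚ.∧-zeroʳ (isMatching G (S - u) M) = ≡.sym (sum-zeros {n} λ _ → ≡.refl)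
  vertex-split S u true M
    rewrite Boolₚ.∧-identityʳ (isMatching G S M) | Boolₚ.∧-identityʳ (isMatching G (S - u) M) with isMatching G S M in e
  ... | false = ≡.sym (≡.cong₂ ℕ._+_ (≡.cong ind (Boolₚ.¬-not λ p → not-matching (matching⁻ (matching-⊆ (Subₚ.p─q⊆p S ⁅ u ⁆) (matching⁺ (S - u) M p)))))
                                     (sum-zeros {n} λ _ → ≡.refl))
    where
    not-matching : ¬ isMatching G S M ≡ true
    not-matching p with () ← ≡.trans (≡.sym e) p
  ... | true with Finₚ.any? (λ c → incident M u c Bool.≟ true)
  ...   | yes (c , uc) = ≡.sym (≡.cong₂ ℕ._+_
            (≡.cong ind (Boolₚ.¬-not λ p → proj₂ (∈-minus⁻ {S = S} (proj₁ (incident-in (matching⁺ (S - u) M p) uc))) ≡.refl))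
            (sum-ind-one (unique (matching⁺ S M e) u) uc))
  ...   | no none = ≡.sym (≡.cong₂ ℕ._+_
            (≡.cong ind (matching⁻ (matching-minus (matching⁺ S M e) λ c p → none (c , p))))
            (sum-zeros λ c → ≡.cong ind (Boolₚ.¬-not λ p → none (c , p))))

  num-split : ∀ S u r → num S r ≡ num (S - u) r ℕ.+
    ℕSum.sum (λ c → total (allEdgeSets n) (λ M → ind (hits S r M ∧ incident M u c)))
  num-split S u r = begin
    num S r
      ≡⟨ num≡total S r ⟩
    total (allEdgeSets n) (ind ∘ hits S r)
      ≡⟨ total-cong (allEdgeSets n) (λ M → vertex-split S u (size M ≡ᵇ r) M) ⟩
    total (allEdgeSets n) (λ M → ind (hits (S - u) r M) ℕ.+ ℕSum.sum (λ c → ind (hits S r M ∧ incident M u c)))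
      ≡⟨ total-+ (allEdgeSets n) (ind ∘ hits (S - u) r) _ ⟩
    total (allEdgeSets n) (ind ∘ hits (S - u) r) ℕ.+ total (allEdgeSets n) (λ M → ℕSum.sum (λ c → ind (hits S r M ∧ incident M u c)))
      ≡⟨ ≡.cong₂ ℕ._+_ (≡.sym (num≡total (S - u) r)) (total-sum (allEdgeSets n) (λ M c → ind (hits S r M ∧ incident M u c))) ⟩
    num (S - u) r ℕ.+ ℕSum.sum (λ c → total (allEdgeSets n) (λ M → ind (hits S r M ∧ incident M u c))) ∎
    where open ≡.≡-Reasoning

  total-none : ∀ {b : EdgeSet n → Bool} → (∀ M → ¬ b M ≡ true) → total (allEdgeSets n) (ind ∘ b) ≡ 0
  total-none none = ≡.trans (total-cong (allEdgeSets n) λ M → ≡.cong ind (Boolₚ.¬-not (none M))) (total-zero (allEdgeSets n))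

  num-zero-minus : ∀ S u → num S 0 ≡ num (S - u) 0
  num-zero-minus S u = ≡.trans (num-split S u 0) (≡.trans (≡.cong (num (S - u) 0 ℕ.+_) (sum-zeros λ c → total-none (impossible c)))
    (ℕₚ.+-identityʳ _))
    where
    positive : ∀ {M i j} → (size M ≡ᵇ 0) ≡ true → ¬ chosen M i j ≡ true
    positive {M} {i} {j} z p rewrite size-toggle i j M p with () ← z
    impossible : ∀ c M → ¬ hits S 0 M ∧ incident M u c ≡ true
    impossible c M p with ∧⁻ {hits S 0 M} p
    ... | h , uc with incident⁻ M u c uc
    ...   | inj₁ q = positive {M} (proj₂ (∧⁻ {isMatching G S M} h)) q
    ...   | inj₂ q = positive {M} (proj₂ (∧⁻ {isMatching G S M} h)) q

  -- Toggling the edge identifies the matchings that contain it with those of `S - i - j`. The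
  -- indicators agree at every `M`, so reindexing finishes.
  total-edge : ∀ S {i j} r → toℕ i < toℕ j → adj G i j ≡ true → i ∈ S → j ∈ S →
    total (allEdgeSets n) (λ M → ind (hits S (suc r) M ∧ incident M i j)) ≡ num (S - i - j) r
  total-edge S {i} {j} r i<j eij i∈S j∈S = ≡.trans
    (total-cong (allEdgeSets n) λ M → ≡.cong ind (bool-ext (to M) (from M)))
    (≡.trans (invariant-toggle i j (ind ∘ hits (S - i - j) r)) (≡.sym (num≡total (S - i - j) r)))
    where
    to : ∀ M → hits S (suc r) M ∧ incident M i j ≡ true → hits (S - i - j) r (toggle i j M) ≡ true
    to M p with ∧⁻ {hits S (suc r) M} p
    ... | h , ij with ∧⁻ {isMatching G S M} h
    ...   | m , s with incident⁻ M i j ij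
    ...     | inj₁ q = ∧⁺ (matching⁻ (remove-edge (matching⁺ S M m) q))
                          (≡.trans (≡.cong (_≡ᵇ suc r) (≡.sym (size-toggle i j M q))) s)
    ...     | inj₂ q = ⊥-elim (ℕₚ.<-asym i<j (ordered (matching⁺ S M m) q))
    from : ∀ M → hits (S - i - j) r (toggle i j M) ≡ true → hits S (suc r) M ∧ incident M i j ≡ true
    from M h with ∧⁻ {isMatching G (S - i - j) (toggle i j M)} h
    ... | m , s = ∧⁺ (∧⁺ (matching⁻ (add-edge (matching⁺ (S - i - j) (toggle i j M) m) i<j eij i∈S j∈S))
                         (≡.trans (≡.cong (_≡ᵇ suc r) (size-toggle i j M q)) s))
                     (incidentˡ M i j q)
      where
      q : chosen M i j ≡ true
      q = was-chosen (matching⁺ (S - i - j) (toggle i j M) m)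

  linked : Subset n → Fin n → ℕ → Fin n → ℕ
  linked S u r c = if link S u c then num (S - u - c) r else 0

  num-suc-minus : ∀ {S u} r → u ∈ S → num S (suc r) ≡ num (S - u) (suc r) ℕ.+ ℕSum.sum (linked S u r)
  num-suc-minus {S} {u} r u∈S = ≡.trans (num-split S u (suc r)) (≡.cong (num (S - u) (suc r) ℕ.+_) (ℕSum.sum-cong-≗ by-neighbour))
    where
    by-neighbour : ∀ c → total (allEdgeSets n) (λ M → ind (hits S (suc r) M ∧ incident M u c)) ≡ linked S u r c
    by-neighbour c with link S u c in e
    ... | false = total-none λ M p → absent M (∧⁻ {hits S (suc r) M} p)
      where
      absent : ∀ M → ¬ (hits S (suc r) M ≡ true × incident M u c ≡ true)
      absent M (h , uc) with incident-in (matching⁺ S M (proj₁ (∧⁻ {isMatching G S M} h))) uc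
      ... | _ , c∈S , u≢c , euc with () ← ≡.trans (≡.sym e) (link⁺ (∈-minus⁺ c∈S λ c≡u → u≢c (≡.sym c≡u)) euc)
    ... | true with link⁻ {S} e
    ...   | c∈ , euc with ∈-minus⁻ c∈ | ℕₚ.<-cmp (toℕ u) (toℕ c)
    ...     | c∈S , _   | tri< u<c _ _ = total-edge S r u<c euc u∈S c∈S
    ...     | c∈S , c≢u | tri≈ _ u≡c _ = ⊥-elim (c≢u (≡.sym (Finₚ.toℕ-injective u≡c)))
    -- An edge is stored with its smaller end first, so `u` and `c` exchange roles.
    ...     | c∈S , _   | tri> _ _ c<u = ≡.trans
      (total-cong (allEdgeSets n) λ M → ≡.cong (λ b → ind (hits S (suc r) M ∧ b)) (Boolₚ.∨-comm (chosen M u c) (chosen M c u)))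
      (≡.trans (total-edge S r c<u (≡.trans (adj-sym G c u) euc) c∈S u∈S) (≡.cong (λ T → num T r) (minus-comm S c u)))

  edgeless : ∀ (M : EdgeSet n) → (∀ i j → ¬ chosen M i j ≡ true) → size M ≡ 0
  edgeless M none = ≡.trans (size≡sum M) (sum-zeros λ i → ≡.trans (∣∣≡sum (lookup M i))
    (sum-zeros λ j → ≡.cong ind (Boolₚ.¬-not (none i j))))

  edgeless⁻ : ∀ (M : EdgeSet n) → size M ≡ 0 → ∀ i j → ¬ chosen M i j ≡ true
  edgeless⁻ M s i j p with () ← ≡.trans (≡.sym s) (size-toggle i j M p)

  num-empty-zero : ∀ {S} → Empty S → num S 0 ≡ 1
  num-empty-zero {S} empty = ≡.trans (num≡total S 0) (≡.trans (total-cong (allEdgeSets n) λ M → ≡.cong ind (bool-ext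
    (λ h → proj₂ (∧⁻ {isMatching G S M} h)) (λ s → ∧⁺ (matching⁻ (trivial M s)) s))) (edgeless-once n))
    where
    trivial : ∀ M → (size M ≡ᵇ 0) ≡ true → Matching S M
    trivial M s = record
      { ordered = λ {i} {j} p → ⊥-elim (none i j p) ; edge = λ {i} {j} p → ⊥-elim (none i j p)
      ; startIn = λ {i} {j} p → ⊥-elim (none i j p) ; endIn = λ {i} {j} p → ⊥-elim (none i j p)
      ; unique = λ v {w} p → ⊥-elim ([ none v w , none w v ] (incident⁻ M v w p)) }
      where
      none : ∀ i j → ¬ chosen M i j ≡ true
      none = edgeless⁻ M (ℕₚ.≡ᵇ⇒≡ (size M) 0 (≡.subst T (≡.sym s) _))

  num-empty-suc : ∀ {S} r → Empty S → num S (suc r) ≡ 0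
  num-empty-suc {S} r empty = ≡.trans (num≡total S (suc r)) (total-none λ M h → impossible M (∧⁻ {isMatching G S M} h))
    where
    impossible : ∀ M → ¬ (isMatching G S M ≡ true × (size M ≡ᵇ suc r) ≡ true)
    impossible M (m , s) with () ← ≡.trans (≡.sym s) (≡.cong (_≡ᵇ suc r) (edgeless M λ i j p → empty (i , startIn (matching⁺ S M m) p)))

  -- In the recurrence the deletion of `u` and `c` lowers the size by two while `r` drops by one.
  -- Terms whose exponent would be negative are thereby harmless.
  num-large : ∀ k S r → ∣ S ∣ < k → ∣ S ∣ < r ℕ.+ r → num S r ≡ 0
  num-large (suc k) S (suc r) s l with Subₚ.nonempty? S
  ... | no empty = num-empty-suc r empty
  ... | yes (u , u∈S) = ≡.trans (num-suc-minus r u∈S) (≡.cong₂ ℕ._+_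
        (num-large k (S - u) (suc r) smaller (ℕₚ.<-trans (Subₚ.x∈p⇒∣p-x∣<∣p∣ u∈S) l)) (sum-zeros branch))
    where
    smaller : ∣ S - u ∣ < k
    smaller = ℕₚ.<-≤-trans (Subₚ.x∈p⇒∣p-x∣<∣p∣ u∈S) (ℕ.s≤s⁻¹ s)
    branch : ∀ c → linked S u r c ≡ 0
    branch c with link S u c in e
    ... | false = ≡.refl
    ... | true  = num-large k (S - u - c) r (ℕₚ.≤-<-trans (Subₚ.∣p─q∣≤∣p∣ (S - u) ⁅ c ⁆) smaller)
      (ℕ.s≤s⁻¹ (ℕ.s≤s⁻¹ (≡.subst₂ _<_ (≡.trans (∣minus∣ u∈S) (≡.cong suc (∣minus∣ (proj₁ (link⁻ {S} e))))) (≡.cong suc (ℕₚ.+-suc r r)) l)))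

-- Polynomials as lists and their expansions at θ

module Taylor (R : RealField) (θ : RealField.Carrier R) where
  open OrderedField R
  open PowerSeries R
  open SeriesSums R
  open Derivative R θ
  open Poly R
  private
    module ≈-Reasoning = Relation.Binary.Reasoning.Setoid setoid
    module ≋-Reasoning = Relation.Binary.Reasoning.Setoid S.setoid

  const : Carrier → Series
  const a zero    = a
  const a (suc _) = 0#

  const-⊛ : ∀ a p → const a ⊛ p ≋ scaled a p
  const-⊛ a p zero    = refl
  const-⊛ a p (suc i) = trans (+-congˡ (⊛-zeroˡ p i)) (+-identityʳ _)

  const-+ : ∀ a b → const (a + b) ≋ const a ⊕ const b
  const-+ a b zero    = refl
  const-+ a b (suc _) = sym (+-identityˡ 0#)

  const-0 : const 0# ≋ 𝟘
  const-0 zero    = refl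
  const-0 (suc _) = refl

  -- Substitution of θ + t for the variable, by Horner's scheme.
  taylor : Pol → Series
  taylor []      = 𝟘
  taylor (a ∷ p) = const a ⊕ var ⊛ taylor p

  -- Lists that differ by trailing zeros represent the same polynomial; this covers the surplus when
  -- one of two lists runs out.
  taylor-zero : ∀ p → (∀ i → coeff p i ≈ 0#) → taylor p ≋ 𝟘
  taylor-zero []      e = S.refl
  taylor-zero (a ∷ p) e = begin
    const a ⊕ var ⊛ taylor p  ≈⟨ S.+-cong (λ { zero → e 0 ; (suc _) → refl }) (S.*-congˡ (taylor-zero p (e ∘ suc))) ⟩
    𝟘 ⊕ var ⊛ 𝟘               ≈⟨ S.trans (S.+-identityˡ _) (S.zeroʳ var) ⟩
    𝟘                         ∎
    where open ≋-Reasoning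

  taylor-cong : ∀ p q → p ≈P q → taylor p ≋ taylor q
  taylor-cong []      q       e = S.sym (taylor-zero q (λ i → sym (e i)))
  taylor-cong (a ∷ p) []      e = taylor-zero (a ∷ p) e
  taylor-cong (a ∷ p) (b ∷ q) e =
    S.+-cong (λ { zero → e 0 ; (suc _) → refl }) (S.*-congˡ (taylor-cong p q (e ∘ suc)))

  taylor-+P : ∀ p q → taylor (p +P q) ≋ taylor p ⊕ taylor q
  taylor-+P []      q       = S.sym (S.+-identityˡ _)
  taylor-+P (a ∷ p) []      = S.sym (S.+-identityʳ _)
  taylor-+P (a ∷ p) (b ∷ q) = begin
    const (a + b) ⊕ var ⊛ taylor (p +P q)
      ≈⟨ S.+-cong (const-+ a b) (S.*-congˡ (taylor-+P p q)) ⟩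
    const a ⊕ const b ⊕ var ⊛ (taylor p ⊕ taylor q)
      ≈⟨ S.+-congˡ (S.distribˡ var _ _) ⟩
    const a ⊕ const b ⊕ (var ⊛ taylor p ⊕ var ⊛ taylor q)
      ≈⟨ interchange _ _ _ _ ⟩
    const a ⊕ var ⊛ taylor p ⊕ (const b ⊕ var ⊛ taylor q) ∎
    where
    open ≋-Reasoning
    open Algebra.Properties.CommutativeSemigroup (CommutativeRing.+-commutativeSemigroup seriesRing) using (interchange)

  taylor-scale : ∀ c p → taylor (scale c p) ≋ const c ⊛ taylor p
  taylor-scale c []      = S.sym (S.zeroʳ (const c))
  taylor-scale c (a ∷ p) = begin
    const (c * a) ⊕ var ⊛ taylor (scale c p)
      ≈⟨ S.+-cong const-* (S.*-congˡ (taylor-scale c p)) ⟩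
    const c ⊛ const a ⊕ var ⊛ (const c ⊛ taylor p)
      ≈⟨ S.+-congˡ (x∙yz≈y∙xz var (const c) (taylor p)) ⟩
    const c ⊛ const a ⊕ const c ⊛ (var ⊛ taylor p)
      ≈⟨ S.distribˡ (const c) _ _ ⟨
    const c ⊛ (const a ⊕ var ⊛ taylor p) ∎
    where
    open ≋-Reasoning
    open Algebra.Properties.CommutativeSemigroup (CommutativeRing.*-commutativeSemigroup seriesRing) using (x∙yz≈y∙xz)
    const-* : const (c * a) ≋ const c ⊛ const a
    const-* zero    = refl
    const-* (suc i) = sym (trans (const-⊛ c (const a) (suc i)) (zeroʳ c))

  taylor-*P : ∀ p q → taylor (p *P q) ≋ taylor p ⊛ taylor q
  taylor-*P []      q = S.sym (S.zeroˡ _)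
  taylor-*P (a ∷ p) q = begin
    taylor (scale a q +P (0# ∷ (p *P q)))
      ≈⟨ taylor-+P (scale a q) (0# ∷ (p *P q)) ⟩
    taylor (scale a q) ⊕ (const 0# ⊕ var ⊛ taylor (p *P q))
      ≈⟨ S.+-cong (taylor-scale a q) (S.trans (S.+-congʳ const-0) (S.+-identityˡ _)) ⟩
    const a ⊛ taylor q ⊕ var ⊛ taylor (p *P q)
      ≈⟨ S.+-congˡ (S.trans (S.*-congˡ (taylor-*P p q)) (S.sym (S.*-assoc _ _ _))) ⟩
    const a ⊛ taylor q ⊕ var ⊛ taylor p ⊛ taylor q
      ≈⟨ S.distribʳ (taylor q) _ _ ⟨
    (const a ⊕ var ⊛ taylor p) ⊛ taylor q ∎
    where open ≋-Reasoning

  coeff-+P : ∀ p q i → coeff (p +P q) i ≈ coeff p i + coeff q i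
  coeff-+P []      q       i       = sym (+-identityˡ _)
  coeff-+P (a ∷ p) []      i       = sym (+-identityʳ _)
  coeff-+P (a ∷ p) (b ∷ q) zero    = refl
  coeff-+P (a ∷ p) (b ∷ q) (suc i) = coeff-+P p q i

  coeff-scale : ∀ c p i → coeff (scale c p) i ≈ c * coeff p i
  coeff-scale c []      i       = sym (zeroʳ c)
  coeff-scale c (a ∷ p) zero    = refl
  coeff-scale c (a ∷ p) (suc i) = coeff-scale c p i

  -- Coefficients embed polynomials in the series ring a second time, now expanded at 0, so
  -- polynomial products inherit its ring laws.
  coeff-*P : ∀ p q → coeff (p *P q) ≋ coeff p ⊛ coeff q
  coeff-*P []      q i       = sym (⊛-zeroˡ (coeff q) i)
  coeff-*P (a ∷ p) q zero    =
    trans (coeff-+P (scale a q) _ 0) (trans (+-identityʳ _) (coeff-scale a q 0))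
  coeff-*P (a ∷ p) q (suc i) =
    trans (coeff-+P (scale a q) _ (suc i)) (+-cong (coeff-scale a q (suc i)) (coeff-*P p q i))

  linear : Pol
  linear = - θ ∷ 1# ∷ []

  linear-⊛-suc : ∀ s i → (coeff linear ⊛ s) (suc i) ≈ - θ * s (suc i) + s i
  linear-⊛-suc s i = +-congˡ (trans (⊛-cong (λ { zero → refl ; (suc _) → refl }) (λ _ → refl) i) (⊛-identityˡ s i))

  private
    τ : Series
    τ zero          = 0#
    τ (suc zero)    = 1#
    τ (suc (suc _)) = 0#

  taylor-linear : taylor linear ≋ τ
  taylor-linear = S.trans (S.+-congˡ (S.trans (S.*-congˡ inner) (S.*-identityʳ var))) λ where
      zero          → -‿inverseˡ θ
      (suc zero)    → +-identityˡ 1#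
      (suc (suc _)) → +-identityˡ 0#
    where
    inner : const 1# ⊕ var ⊛ 𝟘 ≋ 𝟙
    inner = S.trans (S.+-congˡ (S.zeroʳ var)) λ where
      zero    → +-identityʳ 1#
      (suc _) → +-identityʳ 0#

  taylor-linear-⊛-suc : ∀ s i → (taylor linear ⊛ s) (suc i) ≈ s i
  taylor-linear-⊛-suc s i = begin
    (taylor linear ⊛ s) (suc i)         ≈⟨ ⊛-cong taylor-linear (λ _ → refl) (suc i) ⟩
    0# * s (suc i) + (tail τ ⊛ s) i     ≈⟨ +-cong (zeroˡ _) (⊛-cong (λ { zero → refl ; (suc _) → refl }) (λ _ → refl) i) ⟩
    0# + (𝟙 ⊛ s) i                      ≈⟨ trans (+-identityˡ _) (⊛-identityˡ s i) ⟩
    s i                                 ∎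
    where open ≈-Reasoning

  Div-linear-power : ∀ k → Div k (taylor (linear ^P k))
  Div-linear-power (suc k) = Div-resp (S.sym (taylor-*P linear (linear ^P k)))
    (Div-⊛ {1} (λ { (s≤s z≤n) → taylor-linear 0 }) (Div-linear-power k))

  divisible⇒Div : ∀ p k → p ∣[x- θ ]^ k → Div k (taylor p)
  divisible⇒Div p k (q , e) = Div-resp (S.sym (S.trans (taylor-cong p ((linear ^P k) *P q) e) (taylor-*P (linear ^P k) q)))
    (≡.subst (λ m → Div m (taylor (linear ^P k) ⊛ taylor q)) (ℕₚ.+-identityʳ k) (Div-⊛ {k} {0} (Div-linear-power k) λ ()))

  -- Horner's scheme: the value of p at θ is the constant coefficient of taylor p.
  quotient : Pol → Pol
  quotient []      = []
  quotient (a ∷ p) = taylor p 0 ∷ quotient p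

  quotient-remainder : ∀ p → coeff p ≋ coeff linear ⊛ coeff (quotient p) ⊕ const (taylor p 0)
  quotient-remainder [] zero = sym (trans (+-identityʳ _) (zeroʳ _))
  quotient-remainder [] (suc i) = sym (trans (+-identityʳ _) (S.zeroʳ (coeff linear) (suc i)))
  quotient-remainder (a ∷ p) zero = sym (begin
    - θ * r + (a + θ * r)    ≈⟨ +-congˡ (+-comm a (θ * r)) ⟩
    - θ * r + (θ * r + a)    ≈⟨ +-assoc _ _ _ ⟨
    - θ * r + θ * r + a      ≈⟨ +-congʳ (distribʳ r (- θ) θ) ⟨
    (- θ + θ) * r + a        ≈⟨ +-congʳ (trans (*-congʳ (-‿inverseˡ θ)) (zeroˡ r)) ⟩
    0# + a                   ≈⟨ +-identityˡ a ⟩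
    a                        ∎)
    where
    open ≈-Reasoning
    r = taylor p 0
  quotient-remainder (a ∷ p) (suc i) = trans (quotient-remainder p i) (sym (trans (+-identityʳ _)
    (trans (linear-⊛-suc (coeff (quotient (a ∷ p))) i) (shifted i))))
    where
    shifted : ∀ i → - θ * coeff (quotient p) i + coeff (quotient (a ∷ p)) i ≈
              (coeff linear ⊛ coeff (quotient p)) i + const (taylor p 0) i
    shifted zero    = refl
    shifted (suc i) = sym (trans (+-identityʳ _) (linear-⊛-suc (coeff (quotient p)) i))

  -- The constant term of the expansion is the remainder modulo x - θ. Once it vanishes, the
  -- expansion of `quotient p` is that of `p` divided by `t`, and induction applies.
  Div⇒divisible : ∀ p k → Div k (taylor p) → p ∣[x- θ ]^ k
  Div⇒divisible p zero d = p , S.sym (S.trans (coeff-*P (1# ∷ []) p)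
    (S.trans (⊛-cong (λ { zero → refl ; (suc _) → refl }) (λ _ → refl)) (⊛-identityˡ (coeff p))))
  Div⇒divisible p (suc k) d with Div⇒divisible (quotient p) k quotient-Div
    where
    exact : coeff p ≋ coeff (linear *P quotient p)
    exact = S.trans (quotient-remainder p) (S.trans
      (S.+-congˡ (λ { zero → d (s≤s z≤n) ; (suc _) → refl })) (S.trans (S.+-identityʳ _) (S.sym (coeff-*P linear (quotient p)))))
    quotient-Div : Div k (taylor (quotient p))
    quotient-Div {i} i<k = trans (sym (trans (S.trans (taylor-cong p (linear *P quotient p) exact) (taylor-*P linear (quotient p)) (suc i))
      (taylor-linear-⊛-suc (taylor (quotient p)) i))) (d (s≤s i<k))
  ... | q , e = q , (begin
    coeff p
      ≈⟨ quotient-remainder p ⟩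
    coeff linear ⊛ coeff (quotient p) ⊕ const (taylor p 0)
      ≈⟨ S.trans (S.+-congˡ (λ { zero → d (s≤s z≤n) ; (suc _) → refl })) (S.+-identityʳ _) ⟩
    coeff linear ⊛ coeff (quotient p)
      ≈⟨ S.*-congˡ (S.trans e (coeff-*P (linear ^P k) q)) ⟩
    coeff linear ⊛ (coeff (linear ^P k) ⊛ coeff q)
      ≈⟨ S.*-assoc _ _ _ ⟨
    coeff linear ⊛ coeff (linear ^P k) ⊛ coeff q
      ≈⟨ S.*-congʳ (coeff-*P linear (linear ^P k)) ⟨
    coeff (linear *P (linear ^P k)) ⊛ coeff q
      ≈⟨ coeff-*P (linear *P (linear ^P k)) q ⟨
    coeff ((linear *P (linear ^P k)) *P q) ∎)
    where open ≋-Reasoning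

  mult⇒order : ∀ p {k} → IsMult θ p k → Order (taylor p) k
  mult⇒order p {k} (d , ¬d) = dₜ , λ e → ¬d (Div⇒divisible p (suc k) (Div-suc dₜ e))
    where
    dₜ : Div k (taylor p)
    dₜ = divisible⇒Div p k d

  order⇒mult : ∀ p {k} → Order (taylor p) k → IsMult θ p k
  order⇒mult p {k} (d , p≉0) = Div⇒divisible p k d , λ d′ → p≉0 (divisible⇒Div p (suc k) d′ ℕₚ.≤-refl)

-- The matching polynomial satisfies the vertex recurrence

module MatchingSeries (R : RealField) (θ : RealField.Carrier R) {n : ℕ} (G : Graph n) where
  open OrderedField R
  open PowerSeries R
  open SeriesSums R
  open Families R G
  open Derivative R θ
  open Taylor R θ
  open Matchings G
  open Poly R using (Pol; monomial; fromℕ; fromℤ; _+P_)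
  open Algebra.Properties.Ring ring using (-‿distribˡ-*; -‿involutive; -0#≈0#)
  open Algebra.Properties.CommutativeSemigroup (CommutativeRing.*-commutativeSemigroup seriesRing) using (x∙yz≈y∙xz)
  open Relation.Binary.Reasoning.Setoid S.setoid

  -- The sign defined by recursion instead of a parity test, so that consecutive signs are visibly
  -- opposite.
  ε : ℕ → Carrier
  ε zero    = 1#
  ε (suc r) = - ε r

  power : ℕ → Series
  power zero    = 𝟙
  power (suc k) = var ⊛ power k

  signed : ℕ → ℕ → Series → Series
  signed r k p = const (ε r * fromℕ k) ⊛ p

  fromℕ-+ : ∀ k l → fromℕ (k ℕ.+ l) ≈ fromℕ k + fromℕ l
  fromℕ-+ zero    l = sym (+-identityˡ _)
  fromℕ-+ (suc k) l = trans (+-congˡ (fromℕ-+ k l)) (sym (+-assoc _ _ _))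

  const-cong : ∀ {a b} → a ≈ b → const a ≋ const b
  const-cong e zero    = e
  const-cong e (suc _) = refl

  signed-zero : ∀ r p → signed r 0 p ≋ 𝟘
  signed-zero r p = S.trans (S.*-congʳ (S.trans (const-cong (zeroʳ (ε r))) const-0)) (S.zeroˡ p)

  signed-+ : ∀ r k l p → signed r (k ℕ.+ l) p ≋ signed r k p ⊕ signed r l p
  signed-+ r k l p = S.trans (S.*-congʳ (S.trans
    (const-cong (trans (*-congˡ (fromℕ-+ k l)) (distribˡ (ε r) _ _))) (const-+ _ _))) (S.distribʳ p _ _)

  signed-sum : ∀ {m} r (k : Fin m → ℕ) p → signed r (ℕSum.sum k) p ≋ sum (λ c → signed r (k c) p)
  signed-sum {zero}  r k p = signed-zero r p
  signed-sum {suc m} r k p = S.trans (signed-+ r (k zero) (ℕSum.sum (k ∘ suc)) p) (S.+-congˡ (signed-sum r (k ∘ suc) p))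

  signed-cancel : ∀ r k p → signed (suc r) k p ⊕ signed r k p ≋ 𝟘
  signed-cancel r k p = begin
    signed (suc r) k p ⊕ signed r k p                            ≈⟨ S.distribʳ p _ _ ⟨
    (const (- ε r * fromℕ k) ⊕ const (ε r * fromℕ k)) ⊛ p        ≈⟨ S.*-congʳ (const-+ _ _) ⟨
    const (- ε r * fromℕ k + ε r * fromℕ k) ⊛ p                  ≈⟨ S.*-congʳ (S.trans (const-cong cancel) const-0) ⟩
    𝟘 ⊛ p                                                        ≈⟨ S.zeroˡ p ⟩
    𝟘                                                            ∎
    where
    cancel : - ε r * fromℕ k + ε r * fromℕ k ≈ 0#
    cancel = trans (sym (distribʳ (fromℕ k) (- ε r) (ε r))) (trans (*-congʳ (-‿inverseˡ (ε r))) (zeroˡ _))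

  taylor-monomial : ∀ c k → taylor (monomial c k) ≋ const c ⊛ power k
  taylor-monomial c zero    = S.trans (S.trans (S.+-congˡ (S.zeroʳ var)) (S.+-identityʳ _)) (S.sym (S.*-identityʳ _))
  taylor-monomial c (suc k) = S.trans (S.trans (S.+-congʳ const-0) (S.+-identityˡ _))
    (S.trans (S.*-congˡ (taylor-monomial c k)) (x∙yz≈y∙xz var (const c) (power k)))

  taylor-sum : ∀ (term : ℕ → Pol) (g : ℕ → ℕ) k →
    taylor (List.foldr _+P_ [] (List.map term (applyUpTo g k))) ≋ sum {k} (λ i → taylor (term (g (toℕ i))))
  taylor-sum term g zero    = S.refl
  taylor-sum term g (suc k) = S.trans (taylor-+P (term (g 0)) _) (S.+-congˡ (taylor-sum term (g ∘ suc) k))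

  sign-coefficient : ∀ r k → fromℤ ((if r ℕ.% 2 ≡ᵇ 0 then + 1 else -[1+ 0 ]) ℤ.* + k) ≈ ε r * fromℕ k
  sign-coefficient zero k rewrite ℤₚ.*-identityˡ (+ k) = sym (*-identityˡ _)
  sign-coefficient (suc zero) k rewrite ℤₚ.-1*i≡-i (+ k) =
    trans (negated k) (trans (-‿cong (sym (*-identityˡ _))) (-‿distribˡ-* _ _))
    where
    negated : ∀ k → fromℤ (ℤ.- (+ k)) ≈ - fromℕ k
    negated zero    = sym -0#≈0#
    negated (suc k) = refl
  sign-coefficient (suc (suc r)) k = trans
    (reflexive (≡.cong (λ d → fromℤ ((if d ≡ᵇ 0 then + 1 else -[1+ 0 ]) ℤ.* + k)) period))
    (trans (sign-coefficient r k) (*-congʳ (sym (-‿involutive (ε r)))))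
    where
    period : suc (suc r) ℕ.% 2 ≡ r ℕ.% 2
    period = ≡.trans (≡.cong (ℕ._% 2) (ℕₚ.+-comm 2 r)) (DivMod.[m+n]%n≡m%n r 2)

  term : Subset n → ℕ → Series
  term S r = signed r (num S r) (power (∣ S ∣ ℕ.∸ 2 ℕ.* r))

  μ : Subset n → Series
  μ S = taylor (matchingPoly R G S)

  μ-sum : ∀ S → μ S ≋ sum {suc ∣ S ∣} (λ i → term S (toℕ i))
  μ-sum S = S.trans (taylor-sum (λ r → monomial (coefficient r) (∣ S ∣ ℕ.∸ 2 ℕ.* r)) id (suc ∣ S ∣))
    (sum-cong-≋ {suc ∣ S ∣} λ i → S.trans (taylor-monomial (coefficient (toℕ i)) (∣ S ∣ ℕ.∸ 2 ℕ.* toℕ i))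
      (S.*-congʳ (const-cong (sign-coefficient (toℕ i) (num S (toℕ i))))))
    where
    coefficient : ℕ → Carrier
    coefficient r = fromℤ ((if r ℕ.% 2 ≡ᵇ 0 then + 1 else -[1+ 0 ]) ℤ.* + num S r)

  term-vanishes : ∀ S r → ∣ S ∣ < r ℕ.+ r → term S r ≋ 𝟘
  term-vanishes S r l rewrite num-large (suc ∣ S ∣) S r ℕₚ.≤-refl l = signed-zero r _

  sum-extend : ∀ k l (g : ℕ → Series) → (∀ r → k ℕ.≤ r → g r ≋ 𝟘) → k ℕ.≤ l →
               sum {l} (λ i → g (toℕ i)) ≋ sum {k} (λ i → g (toℕ i))
  sum-extend zero    l       g z k≤l = sum-zero {l} λ i → z (toℕ i) z≤n
  sum-extend (suc k) (suc l) g z (s≤s k≤l) = S.+-congˡ (sum-extend k l (g ∘ suc) (λ r k≤r → z (suc r) (s≤s k≤r)) k≤l)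

  -- The summation range depends on the size of the set. Padding with vanishing terms gives `S`,
  -- `S - u` and `S - u - c` ranges that can be added termwise.
  μ-extended : ∀ S l → ∣ S ∣ < l → μ S ≋ sum {l} (λ i → term S (toℕ i))
  μ-extended S l s = S.trans (μ-sum S) (S.sym (sum-extend (suc ∣ S ∣) l (term S)
    (λ r s≤r → term-vanishes S r (ℕₚ.≤-trans s≤r (ℕₚ.m≤m+n r r))) s))

  -- Truncated subtraction makes the exponents disagree only when `r + r` exceeds the size of
  -- `S - u`, and then the coefficient is zero.
  power-step : ∀ S {u} r → u ∈ S →
    var ⊛ signed r (num (S - u) r) (power (∣ S - u ∣ ℕ.∸ 2 ℕ.* r)) ≋ signed r (num (S - u) r) (power (∣ S ∣ ℕ.∸ 2 ℕ.* r))
  power-step S {u} r u∈S with ∣ S - u ∣ ℕ.<? r ℕ.+ r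
  ... | yes l rewrite num-large (suc ∣ S - u ∣) (S - u) r ℕₚ.≤-refl l =
    S.trans (S.*-congˡ (signed-zero r _)) (S.trans (S.zeroʳ var) (S.sym (signed-zero r _)))
  ... | no ¬l = S.trans (x∙yz≈y∙xz var _ _) (S.*-congˡ (S.reflexive (≡.cong power exponent)))
    where
    exponent : suc (∣ S - u ∣ ℕ.∸ 2 ℕ.* r) ≡ ∣ S ∣ ℕ.∸ 2 ℕ.* r
    exponent = ≡.trans (≡.sym (ℕₚ.+-∸-assoc 1 (≡.subst (ℕ._≤ ∣ S - u ∣) (≡.cong (r ℕ.+_) (≡.sym (ℕₚ.+-identityʳ r))) (ℕₚ.≮⇒≥ ¬l))))
      (≡.cong (ℕ._∸ 2 ℕ.* r) (≡.sym (∣minus∣ u∈S)))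

  term-zero-step : ∀ S {u} → u ∈ S → term S 0 ≋ var ⊛ term (S - u) 0
  term-zero-step S {u} u∈S = S.trans (S.reflexive (≡.cong (λ k → signed 0 k (power ∣ S ∣)) (num-zero-minus S u)))
    (S.sym (power-step S 0 u∈S))

  -- Matchings that use an edge at `u` enter with `suc r` edges in `S` and with `r` in `S - u - c`,
  -- hence with opposite signs and the same power; they cancel.
  term-suc-step : ∀ S {u} r → u ∈ S →
    term S (suc r) ⊕ sum (λ c → on (link S u c) (term (S - u - c) r)) ≋ var ⊛ term (S - u) (suc r)
  term-suc-step S {u} r u∈S = begin
    term S (suc r) ⊕ sum (λ c → on (link S u c) (term (S - u - c) r))
      ≈⟨ S.+-cong (S.reflexive (≡.cong (λ k → signed (suc r) k P) (num-suc-minus r u∈S))) (sum-cong-≋ branch) ⟩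
    signed (suc r) (num (S - u) (suc r) ℕ.+ ℕSum.sum (linked S u r)) P ⊕ sum (λ c → signed r (linked S u r c) P)
      ≈⟨ S.+-cong (signed-+ (suc r) (num (S - u) (suc r)) _ P) (S.sym (signed-sum r (linked S u r) P)) ⟩
    signed (suc r) (num (S - u) (suc r)) P ⊕ signed (suc r) (ℕSum.sum (linked S u r)) P ⊕ signed r (ℕSum.sum (linked S u r)) P
      ≈⟨ S.trans (S.+-assoc _ _ _) (S.trans (S.+-congˡ (signed-cancel r (ℕSum.sum (linked S u r)) P)) (S.+-identityʳ _)) ⟩
    signed (suc r) (num (S - u) (suc r)) P
      ≈⟨ power-step S (suc r) u∈S ⟨
    var ⊛ term (S - u) (suc r) ∎
    where
    P : Series
    P = power (∣ S ∣ ℕ.∸ 2 ℕ.* suc r)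
    branch : ∀ c → on (link S u c) (term (S - u - c) r) ≋ signed r (linked S u r c) P
    branch c with link S u c in e
    ... | false = S.sym (signed-zero r P)
    ... | true  = S.*-congˡ (S.reflexive (≡.cong power (≡.sym exponent)))
      where
      exponent : ∣ S ∣ ℕ.∸ 2 ℕ.* suc r ≡ ∣ S - u - c ∣ ℕ.∸ 2 ℕ.* r
      exponent = ≡.cong₂ ℕ._∸_ (≡.trans (∣minus∣ u∈S) (≡.cong suc (∣minus∣ (proj₁ (link⁻ {S} e))))) (ℕₚ.*-suc 2 r)

  μ-family : Family (λ _ → var) μ
  μ-family S u u∈S = begin
    μ S ⊕ sum (links μ S u)
      ≈⟨ S.+-cong (μ-extended S (suc b) (ℕₚ.≤-refl)) (S.trans (sum-cong-≋ branch)
           (∑-comm (λ c (i : Fin b) → on (link S u c) (term (S - u - c) (toℕ i))))) ⟩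
    term S 0 ⊕ sum {b} (λ i → term S (suc (toℕ i))) ⊕ sum {b} (λ i → sum (λ c → on (link S u c) (term (S - u - c) (toℕ i))))
      ≈⟨ S.trans (S.+-assoc _ _ _) (S.+-cong (term-zero-step S u∈S) (S.sym (∑-distrib-+ {b} (λ i → term S (suc (toℕ i)))
           λ i → sum (λ c → on (link S u c) (term (S - u - c) (toℕ i)))))) ⟩
    var ⊛ term (S - u) 0 ⊕ sum {b} (λ i → term S (suc (toℕ i)) ⊕ sum (λ c → on (link S u c) (term (S - u - c) (toℕ i))))
      ≈⟨ S.+-congˡ (sum-cong-≋ {b} λ i → term-suc-step S (toℕ i) u∈S) ⟩
    var ⊛ term (S - u) 0 ⊕ sum {b} (λ i → var ⊛ term (S - u) (suc (toℕ i)))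
      ≈⟨ *-distribˡ-sum var (λ (i : Fin (suc b)) → term (S - u) (toℕ i)) ⟨
    var ⊛ sum {suc b} (λ i → term (S - u) (toℕ i))
      ≈⟨ S.*-congˡ (μ-extended (S - u) (suc b) (ℕₚ.<-trans (Subₚ.x∈p⇒∣p-x∣<∣p∣ u∈S) ℕₚ.≤-refl)) ⟨
    var ⊛ μ (S - u) ∎
    where
    b : ℕ
    b = ∣ S ∣
    branch : ∀ c → links μ S u c ≋ sum {b} (λ i → on (link S u c) (term (S - u - c) (toℕ i)))
    branch c = S.trans (on-cong (link S u c) (μ-extended (S - u - c) b
        (ℕₚ.≤-<-trans (Subₚ.∣p─q∣≤∣p∣ (S - u) ⁅ c ⁆) (Subₚ.x∈p⇒∣p-x∣<∣p∣ u∈S))))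
      (on-sum (link S u c) {b} (λ i → term (S - u - c) (toℕ i)))

  μ-empty : ∀ {S} → Empty S → μ S ≋ 𝟙
  μ-empty {S} empty = S.trans (μ-extended S 1 (s≤s (ℕₚ.≤-reflexive card))) (S.trans (S.+-identityʳ _) (S.trans
    (S.reflexive (≡.cong₂ (λ k l → signed 0 k (power l)) (num-empty-zero empty) card))
    (S.trans (S.*-identityʳ _) λ { zero → trans (*-identityˡ _) (+-identityʳ 1#) ; (suc _) → refl })))
    where
    card : ∣ S ∣ ≡ 0
    card with ≡.refl ← Subₚ.Empty-unique empty = Subₚ.∣⊥∣≡0 n

-- From multiplicities to orders, and the theorem

module _ (R : RealField) (θ : RealField.Carrier R) {n : ℕ} (G : Graph n) where
  open PowerSeries R using (order-unique)
  open Taylor R θ using (mult⇒order; order⇒mult)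
  open MatchingSeries R θ G using (μ; μ-family; μ-empty)
  open Orders R θ G μ μ-family μ-empty
  open SpecialVertices R θ G μ μ-family μ-empty

  mult⇒ord : ∀ S k → Mult R θ G S k → ord S ≡ k
  mult⇒ord S k m = order-unique (ord-order S) (mult⇒order (matchingPoly R G S) m)

  ord⇒mult : ∀ S {k} → ord S ≡ k → Mult R θ G S k
  ord⇒mult S e = order⇒mult (matchingPoly R G S) (order-at e)

  essential⇒ess : ∀ {u} → Essential R θ G u → Ess ⊤ u
  essential⇒ess {u} (m , p , q) = ≡.trans (mult⇒ord ⊤ (suc m) p) (≡.cong suc (≡.sym (mult⇒ord (⊤ - u) m q)))

  ess⇒essential : ∀ {u} → Ess ⊤ u → Essential R θ G u
  ess⇒essential {u} e = ord (⊤ - u) , ord⇒mult ⊤ e , ord⇒mult (⊤ - u) ≡.refl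

  special⇒specialIn : ∀ {u} → Special R θ G u → SpecialIn ⊤ u
  special⇒specialIn (¬e , w , uw , ew) =
    special Subₚ.∈⊤ (λ e → ¬e (ess⇒essential e)) Subₚ.∈⊤ uw (essential⇒ess ew)

  inPN⇒¬ess : ∀ {u} → InPN R θ G u → ¬ Ess ⊤ u
  inPN⇒¬ess {u} (inj₁ ((m , p , q) , _)) e =
    ℕₚ.<⇒≢ (ℕ.s≤s (ℕₚ.n≤1+n m)) (≡.trans (≡.sym (mult⇒ord ⊤ m p)) (≡.trans e (≡.cong suc (mult⇒ord (⊤ - u) (suc m) q))))
  inPN⇒¬ess {u} (inj₂ (m , p , q)) e =
    ℕₚ.<⇒≢ (ℕₚ.n<1+n m) (≡.trans (≡.sym (mult⇒ord ⊤ m p)) (≡.trans e (≡.cong suc (mult⇒ord (⊤ - u) m q))))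

  -- For positive vertices this is part of the hypothesis; a neutral one cannot be special because
  -- deleting a special vertex raises the order.
  inPN⇒¬special : ∀ {u} → InPN R θ G u → ¬ Special R θ G u
  inPN⇒¬special (inj₁ (_ , ¬sp)) sp = ¬sp sp
  inPN⇒¬special {u} (inj₂ (m , p , q)) sp = ℕₚ.<⇒≢ (ℕₚ.n<1+n m)
    (≡.trans (≡.sym (mult⇒ord (⊤ - u) m q)) (≡.trans (special-ord (special⇒specialIn sp)) (≡.cong suc (mult⇒ord ⊤ m p))))

open import Data.Nat using (_+_)

theorem5p16 : (R : RealField) (θ : RealField.Carrier R) {n : ℕ} (G : Graph n)
    (u v : Fin n) → u ≢ v → InPN R θ G u → InPN R θ G v →
    -- A is the set A_θ(G) of θ-special vertices
    (A : Subset n) → (∀ w → (w ∈ A) ⇔ Special R θ G w) →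
    -- mult(θ, G \ uv) = m  implies  mult(θ, G \ (A ∪ {u,v})) = m + |A|
    (m : ℕ) → Mult R θ G (⊤ - u - v) m →
    Mult R θ G (⊤ ─ (A ∪ ⁅ u ⁆ ∪ ⁅ v ⁆)) (m + ∣ A ∣)
theorem5p16 R θ {n} G u v u≢v uPN vPN A isA m mult = ord⇒mult R θ G (⊤ ─ (A ∪ ⁅ u ⁆ ∪ ⁅ v ⁆)) (begin
    ord (⊤ ─ (A ∪ ⁅ u ⁆ ∪ ⁅ v ⁆))  ≡⟨ ≡.cong ord regroup ⟩
    -- The ambient set is `⊤ - u`: as `u` is inessential, all of `A` is still special there, and `v`
    -- is the vertex deleted last.
    ord (((⊤ - u) ─ A) - v)        ≡⟨ special-extreme ∣ A ∣ ≡.refl special-after-u v∈⊤-u (avoids vPN) ⟩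
    ∣ A ∣ + ord (⊤ - u - v)        ≡⟨ ≡.cong (λ k → ∣ A ∣ + k) (mult⇒ord R θ G (⊤ - u - v) m mult) ⟩
    ∣ A ∣ + m                      ≡⟨ ℕₚ.+-comm ∣ A ∣ m ⟩
    m + ∣ A ∣                      ∎)
  where
  open MatchingSeries R θ G using (μ; μ-family; μ-empty)
  open Orders R θ G μ μ-family μ-empty using (ord)
  open SpecialVertices R θ G μ μ-family μ-empty
  open ≡.≡-Reasoning
  avoids : ∀ {w} → InPN R θ G w → w ∉ A
  avoids {w} wPN w∈A = inPN⇒¬special R θ G wPN (Equivalence.to (isA w) w∈A)
  v∈⊤-u : v ∈ ⊤ - u
  v∈⊤-u = ∈-minus⁺ Subₚ.∈⊤ λ v≡u → u≢v (≡.sym v≡u)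
  special-after-u : ∀ {a} → a ∈ A → SpecialIn (⊤ - u) a
  special-after-u {a} a∈A = special-minus (special⇒specialIn R θ G (Equivalence.to (isA a) a∈A))
    Subₚ.∈⊤ (λ { ≡.refl → avoids uPN a∈A }) (inPN⇒¬ess R θ G uPN)
  regroup : ⊤ ─ (A ∪ ⁅ u ⁆ ∪ ⁅ v ⁆) ≡ ((⊤ - u) ─ A) - v
  regroup = ≡.trans (≡.sym (Subₚ.p─q─r≡p─q∪r ⊤ A (⁅ u ⁆ ∪ ⁅ v ⁆)))
    (≡.trans (≡.sym (Subₚ.p─q─r≡p─q∪r (⊤ ─ A) ⁅ u ⁆ ⁅ v ⁆)) (≡.cong (_- v) (Subₚ.p─q─r≡p─r─q ⊤ A ⁅ u ⁆)))
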